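{- For every prime $q\ge 3$, every $r\ge 2$ and every $i\in\{0,\dots,\lfloor r/2\rfloor\}$ there is a permutation $\tau$ of $F_q^r$ such that the code $S_\tau$ is a propelinear $q$-ary code of length $\frac{q^{r+1}-1}{q-1}$ and rank $\frac{q^{r+1}-1}{q-1}-r-1+2i$.
   Context: Let $n=\frac{q^r-1}{q-1}$. Let $H_C$ be an $r\times n$ matrix over $F_q$ whose columns are representatives of the $n$ distinct one-dimensional subspaces of $F_q^r$, and for $a\in F_q^r$ let $C_a=\{x\in F_q^n: H_Cx^T=a\}$. Let $D$ be the linear code of length $q^r$ with positions indexed by vectors of $F_q^r$, $D=\{y=(y_c)_{c\in F_q^r}: \sum_c y_c=0,\ \sum_c y_c c={\bf 0}\}$, let $e_c$ be the unit vector at position $c$, and $D_a=D+e_{\bf 0}-e_a$. For a permutation $\tau$ of $F_q^r$, $S_\tau=\bigcup_{a\in F_q^r}C_a\times D_{\tau(a)}=\{(x|y):a\in F_q^r,\ x\in C_a,\ y\in D_{\tau(a)}\}$, where $|$ is concatenation. The rank of a code is the dimension of its $F_q$-linear span. A code $S\subseteq F_q^N$ is propelinear if the group of isometries of $F_q^N$ with respect to the Hamming metric that stabilize $S$ setwise contains a subgroup acting regularly on $S$. -}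

module Defs where

open import Level using (Level; suc; zero)
open import Data.Nat as ℕ using (ℕ; NonZero; _∸_; _^_)
open import Data.Nat.DivMod using (_mod_)
open import Data.Fin as Fin using (Fin; toℕ)
open import Data.Vec using (Vec; []; _∷_; _++_; tabulate; zipWith; map; replicate; foldr)
open import Data.Vec.Properties using (≡-dec)
open import Data.Vec.Relation.Unary.All using (All)
open import Data.Bool using (if_then_else_)
open import Data.Product using (Σ; ∃; ∃-syntax; _×_)
open import Function using (_∘_; id; _↔_; Inverse)
open import Relation.Binary.PropositionalEquality using (_≡_; _≢_; _≗_)
open import Relation.Nullary.Decidable using (⌊_⌋)

-- (q^m - 1)/(q - 1), with truncated subtraction and floor division;
-- the divisor q - 1 is nonzero as soon as q ≥ 2 (for q ∈ {0,1} the value is irrelevant).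
geomLen : ℕ → ℕ → ℕ
geomLen (ℕ.suc (ℕ.suc k)) m = ((ℕ.suc (ℕ.suc k)) ^ m ∸ 1) ℕ./ ℕ.suc k
geomLen _ _ = 0

module _ (q : ℕ) .{{_ : NonZero q}} where

  F : Set
  F = Fin q

  0F 1F : F
  0F = 0 mod q
  1F = 1 mod q

  _+F_ _*F_ : F → F → F
  a +F b = (toℕ a ℕ.+ toℕ b) mod q
  a *F b = (toℕ a ℕ.* toℕ b) mod q

  -F_ : F → F
  -F a = (q ∸ toℕ a) mod q

  _+V_ : ∀ {m} → Vec F m → Vec F m → Vec F m
  _+V_ = zipWith _+F_

  _-V_ : ∀ {m} → Vec F m → Vec F m → Vec F m
  u -V v = u +V map -F_ v

  _·V_ : ∀ {m} → F → Vec F m → Vec F m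
  c ·V v = map (c *F_) v

  0V : ∀ {m} → Vec F m
  0V = replicate _ 0F

  sumF : ∀ {m} → Vec F m → F
  sumF = foldr _ _+F_ 0F

  sumV : ∀ {k m} → Vec (Vec F m) k → Vec F m
  sumV = foldr _ _+V_ 0V

  lincomb : ∀ {k m} → Vec F k → Vec (Vec F m) k → Vec F m
  lincomb c w = sumV (zipWith _·V_ c w)

  -- Hamming code C
  -- H is given by its n columns h_1..h_n ∈ F_q^r.  The columns represent
  -- n pairwise distinct one-dimensional subspaces: each is nonzero and no
  -- column is a scalar multiple of a different column.
  IsHammingCheck : (r n : ℕ) → Vec (Vec F r) n → Set
  IsHammingCheck r n H =
      (∀ j → Data.Vec.lookup H j ≢ 0V)
    × (∀ j k (λ' : F) → Data.Vec.lookup H j ≡ λ' ·V Data.Vec.lookup H k → j ≡ k)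

  C : ∀ {r n} → Vec (Vec F r) n → Vec F r → Vec F n → Set
  C H a x = lincomb x H ≡ a

  -- The code D of length q^r, positions indexed by F_q^r via a bijection
  -- e : Fin (q^r) ↔ F_q^r (position j carries the vector e(j)).
  module _ {r : ℕ} (e : Fin (q ^ r) ↔ Vec F r) where

    pos : Fin (q ^ r) → Vec F r
    pos = Inverse.to e

    D : Vec F (q ^ r) → Set
    D y = (sumF y ≡ 0F) × (lincomb y (tabulate pos) ≡ 0V)

    unit : Vec F r → Vec F (q ^ r)
    unit c = tabulate (λ j → if ⌊ ≡-dec Fin._≟_ (pos j) c ⌋ then 1F else 0F)

    Dc : Vec F r → Vec F (q ^ r) → Set
    Dc a y = ∃[ d ] (D d × y ≡ (d +V unit 0V) -V unit a)

    S : ∀ {n} → Vec (Vec F r) n → (Vec F r ↔ Vec F r) → Vec F (n ℕ.+ q ^ r) → Set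
    S H τ w = ∃[ a ] ∃[ x ] ∃[ y ] (C H a x × Dc (Inverse.to τ a) y × w ≡ x ++ y)

  InSpan : ∀ {ℓ N} → (Vec F N → Set ℓ) → Vec F N → Set ℓ
  InSpan {N = N} Sc v = ∃[ m ] Σ (Vec F m) λ c → Σ (Vec (Vec F N) m) λ w → All Sc w × lincomb c w ≡ v

  LinIndep : ∀ {k N} → Vec (Vec F N) k → Set
  LinIndep b = ∀ c → lincomb c b ≡ 0V → c ≡ 0V

  HasRank : ∀ {ℓ N} → (Vec F N → Set ℓ) → ℕ → Set ℓ
  HasRank {N = N} Sc k = Σ (Vec (Vec F N) k) λ b →
    All (InSpan Sc) b × LinIndep b × (∀ v → Sc v → Σ (Vec F k) λ c → lincomb c b ≡ v)

  dH : ∀ {N} → Vec F N → Vec F N → ℕ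
  dH [] [] = 0
  dH (a ∷ u) (b ∷ v) = (if ⌊ a Fin.≟ b ⌋ then 0 else 1) ℕ.+ dH u v

  IsIsometry : ∀ {N} → (Vec F N → Vec F N) → Set
  IsIsometry φ = ∀ u v → dH (φ u) (φ v) ≡ dH u v

  -- φ stabilises Sc setwise (φ is a bijection, so φ(Sc) = Sc iff this holds)
  Stabilises : ∀ {ℓ N} → (Vec F N → Set ℓ) → (Vec F N → Vec F N) → Set ℓ
  Stabilises Sc φ = ∀ x → (Sc x → Sc (φ x)) × (Sc (φ x) → Sc x)

  -- G is a subgroup (under composition, elements identified pointwise) of the
  -- group of Hamming isometries of F_q^N stabilising Sc, acting regularly on Sc.
  IsRegularSubgroup : ∀ {ℓ N} → (Vec F N → Set ℓ) → ((Vec F N → Vec F N) → Set) → Set ℓ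
  IsRegularSubgroup Sc G =
      (∀ g → G g → IsIsometry g × Stabilises Sc g)
    × G id
    × (∀ g h → G g → G h → G (g ∘ h))
    × (∀ g → G g → Σ _ λ h → G h × (h ∘ g ≗ id) × (g ∘ h ≗ id))
    × (∀ x y → Sc x → Sc y → Σ _ λ g → G g × g x ≡ y)
    × (∀ g h x → G g → G h → Sc x → g x ≡ h x → g ≗ h)

  IsPropelinear : ∀ {ℓ N} → (Vec F N → Set ℓ) → Set (Level.suc Level.zero Level.⊔ ℓ)
  IsPropelinear Sc = ∃[ G ] IsRegularSubgroup Sc G

{-# OPTIONS --safe #-}
module Submission where

-- Split F_q^r into i planes and a complement. On each plane put φ(a, b) = (a, b + a²); it
-- satisfies φ(p + p′) = A_p φ(p′) + φ(p) with A_p a shear, so the affine maps v ↦ A_p v + φ(p)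
-- form a regular elementary abelian group. With σ the exchange of a and b in every plane,
-- take τ(φ(p)) = φ(σ p). Then S_τ consists of the words (x|y) with H x = φ(p), Σ y_c = 0 and
-- Σ y_c c = −φ(σ p) for some p, the "degree" of the word.
--
-- The columns of H, and likewise the vectors (1, c), represent distinct lines that are permuted by
-- the shears, so A_p and A_{σ p} lift uniquely to monomial maps, hence to a homomorphism
-- p ↦ L_p into the isometries. The maps z ↦ L_p z + w, for w ∈ S_τ of degree p, form the
-- regular group.
--
-- The vectors (φ(p), −φ(σ p)) = (a, b + a², −b, −a − b²) span all of F_q^4 for each plane since
-- 2 is invertible. So the span of S_τ is cut out by Σ y_c = 0 and the r − 2i equations saying
-- that H x + Σ y_c c vanishes on the complement.

open import Defs
open import Algebra.Bundles using (CommutativeRing; CommutativeMonoid; AbelianGroup)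
import Algebra.Properties.AbelianGroup
import Algebra.Properties.CommutativeMonoid.Sum
import Algebra.Properties.CommutativeSemigroup
import Algebra.Properties.Ring
import Algebra.Solver.Ring.NaturalCoefficients.Default
open import Data.Bool using (if_then_else_)
open import Data.Empty using (⊥-elim)
open import Data.Fin using (Fin; toℕ; _≟_; punchOut; remQuot; combine; punchIn)
open import Data.Fin.Permutation using (Permutation′; permutation; _⟨$⟩ʳ_)
open import Data.Fin.Properties using (toℕ-fromℕ<; toℕ-injective; toℕ<n; any?; <⇒notInjective; punchOut-injective; combine-remQuot; punchInᵢ≢i; punchIn-injective)
import Data.Nat as ℕ
open import Data.Nat using (ℕ; NonZero; _≤_; _+_; _*_; _∸_; _^_; _/_; _<_; s≤s; z≤n)
open import Data.Nat.DivMod using (_mod_; _%_; %-distribˡ-+; %-distribˡ-*; m%n<n; m<n⇒m%n≡m; [m+n]%n≡m%n; m*n/n≡m; m/n*n≤m)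
open import Data.Nat.Divisibility using (_∣_; m%n≡0⇒n∣m; n∣m⇒m%n≡0)
open import Data.Nat.Primality using (Prime; euclidsLemma; prime⇒nonTrivial)
import Data.Nat.Properties as ℕₚ
open import Data.Product using (_×_; ∃-syntax; _,_; Σ; proj₁; proj₂)
open import Data.Sum as Sum using (_⊎_; [_,_])
open import Data.Vec using (Vec; []; _∷_; _++_; map; lookup; tabulate; head; tail; take; drop)
open import Data.Vec.Properties using (zipWith-assoc; zipWith-comm; zipWith-identityˡ; zipWith-identityʳ; zipWith-inverseˡ; zipWith-inverseʳ; lookup∘tabulate; lookup-zipWith; lookup-map; tabulate∘lookup; tabulate-cong; lookup-replicate; ∷-injective; ++-injective; ≡-dec; take++drop≡id; zipWith-++; map-++)
import Data.Vec.Relation.Unary.All as All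
import Data.Vec.Relation.Unary.All.Properties as All
open import Function using (_↔_; _∘_; id; mk↔ₛ′; Inverse)
open import Function.Definitions using (Injective)
open import Relation.Binary.PropositionalEquality using (_≡_; _≢_; refl; sym; trans; cong; cong₂; subst; isEquivalence; _≗_; module ≡-Reasoning; subst₂)
open import Relation.Nullary using (yes; no; ⌊_⌋)

-- The set of degrees is an additive group, so `σ` has to be additive for `p ↦ A_{σ p}` to be a
-- homomorphism again. Any additive bijection would give a propelinear code; the choice of `σ` only
-- governs the rank. With `σ` the identity, `τ` is the identity as well and `S_τ` is linear of
-- codimension r + 1. Exchanging `a` and `b` puts a square on each side and sets it against
-- different linear terms: `b + a²` against `−b`, and `a` against `−a − b²`. No linear relation
-- survives, so a plane fills four dimensions of syndromes instead of two, which is the origin of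
-- the summand `2i`.
--
-- The map `φ` may be nonlinear although every `A_p` is linear because expanding `(a + a′)²` leaves
-- a cross term `2aa′` that is linear in `a′`. The identity `φ(p + p′) = A_p φ(p′) + φ(p)` makes `φ`
-- a 1-cocycle, and this is exactly what makes degrees add when a word `w` of degree `p` is added to
-- `L_p z`.

-- The ring of residues modulo q

module ModularArithmetic (q : ℕ) .{{_ : NonZero q}} where

  infixl 6 _⊕_
  infixl 7 _⊗_
  infix 8 ⊖_

  _⊕_ _⊗_ : F q → F q → F q
  _⊕_ = _+F_ q
  _⊗_ = _*F_ q

  ⊖_ : F q → F q
  ⊖_ = -F_ q

  𝟎 𝟏 : F q
  𝟎 = 0F q
  𝟏 = 1F q

  toℕ-mod : ∀ m → toℕ (m mod q) ≡ m % q
  toℕ-mod m = toℕ-fromℕ< (m%n<n m q)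

  mod-toℕ : ∀ a → toℕ a mod q ≡ a
  mod-toℕ a = toℕ-injective (trans (toℕ-mod (toℕ a)) (m<n⇒m%n≡m (toℕ<n a)))

  mod-+ : ∀ m n → (m mod q) ⊕ (n mod q) ≡ (m + n) mod q
  mod-+ m n = toℕ-injective (trans (toℕ-mod _) (trans
    (cong₂ (λ k l → (k + l) % q) (toℕ-mod m) (toℕ-mod n))
    (trans (sym (%-distribˡ-+ m n q)) (sym (toℕ-mod _)))))

  mod-* : ∀ m n → (m mod q) ⊗ (n mod q) ≡ (m * n) mod q
  mod-* m n = toℕ-injective (trans (toℕ-mod _) (trans
    (cong₂ (λ k l → (k * l) % q) (toℕ-mod m) (toℕ-mod n))
    (trans (sym (%-distribˡ-* m n q)) (sym (toℕ-mod _)))))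

  -- Reduction of one summand or factor can be postponed. These absorption rules carry associativity
  -- and distributivity over from ℕ.
  +F-mod : ∀ a n → a ⊕ (n mod q) ≡ (toℕ a + n) mod q
  +F-mod a n = trans (cong (_⊕ (n mod q)) (sym (mod-toℕ a))) (mod-+ (toℕ a) n)

  mod-+F : ∀ n a → (n mod q) ⊕ a ≡ (n + toℕ a) mod q
  mod-+F n a = trans (cong ((n mod q) ⊕_) (sym (mod-toℕ a))) (mod-+ n (toℕ a))

  *F-mod : ∀ a n → a ⊗ (n mod q) ≡ (toℕ a * n) mod q
  *F-mod a n = trans (cong (_⊗ (n mod q)) (sym (mod-toℕ a))) (mod-* (toℕ a) n)

  mod-*F : ∀ n a → (n mod q) ⊗ a ≡ (n * toℕ a) mod q
  mod-*F n a = trans (cong ((n mod q) ⊗_) (sym (mod-toℕ a))) (mod-* n (toℕ a))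

  +F-comm : ∀ a b → a ⊕ b ≡ b ⊕ a
  +F-comm a b = cong (_mod q) (ℕₚ.+-comm (toℕ a) (toℕ b))

  *F-comm : ∀ a b → a ⊗ b ≡ b ⊗ a
  *F-comm a b = cong (_mod q) (ℕₚ.*-comm (toℕ a) (toℕ b))

  +F-assoc : ∀ a b c → (a ⊕ b) ⊕ c ≡ a ⊕ (b ⊕ c)
  +F-assoc a b c = trans (mod-+F _ c) (trans
    (cong (_mod q) (ℕₚ.+-assoc (toℕ a) _ _)) (sym (+F-mod a _)))

  *F-assoc : ∀ a b c → (a ⊗ b) ⊗ c ≡ a ⊗ (b ⊗ c)
  *F-assoc a b c = trans (mod-*F _ c) (trans
    (cong (_mod q) (ℕₚ.*-assoc (toℕ a) _ _)) (sym (*F-mod a _)))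

  +F-identityˡ : ∀ a → 𝟎 ⊕ a ≡ a
  +F-identityˡ a = trans (mod-+F 0 a) (mod-toℕ a)

  +F-identityʳ : ∀ a → a ⊕ 𝟎 ≡ a
  +F-identityʳ a = trans (+F-comm a 𝟎) (+F-identityˡ a)

  *F-identityˡ : ∀ a → 𝟏 ⊗ a ≡ a
  *F-identityˡ a = trans (mod-*F 1 a) (trans (cong (_mod q) (ℕₚ.*-identityˡ (toℕ a))) (mod-toℕ a))

  *F-identityʳ : ∀ a → a ⊗ 𝟏 ≡ a
  *F-identityʳ a = trans (*F-comm a 𝟏) (*F-identityˡ a)

  *F-distribˡ-+F : ∀ a b c → a ⊗ (b ⊕ c) ≡ (a ⊗ b) ⊕ (a ⊗ c)
  *F-distribˡ-+F a b c = trans (*F-mod a _) (trans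
    (cong (_mod q) (ℕₚ.*-distribˡ-+ (toℕ a) _ _)) (sym (mod-+ _ _)))

  *F-distribʳ-+F : ∀ a b c → (b ⊕ c) ⊗ a ≡ (b ⊗ a) ⊕ (c ⊗ a)
  *F-distribʳ-+F a b c = trans (*F-comm _ a) (trans
    (*F-distribˡ-+F a b c) (cong₂ _⊕_ (*F-comm a b) (*F-comm a c)))

  +F-inverseʳ : ∀ a → a ⊕ (⊖ a) ≡ 𝟎
  +F-inverseʳ a = trans (+F-mod a _) (trans
    (cong (_mod q) (ℕₚ.m+[n∸m]≡n (ℕₚ.<⇒≤ (toℕ<n a))))
    (toℕ-injective (trans (toℕ-mod q) (trans ([m+n]%n≡m%n 0 q) (sym (toℕ-mod 0))))))

  +F-inverseˡ : ∀ a → (⊖ a) ⊕ a ≡ 𝟎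
  +F-inverseˡ a = trans (+F-comm _ a) (+F-inverseʳ a)

  commutativeRing : CommutativeRing _ _
  commutativeRing = record
    { Carrier = F q ; _≈_ = _≡_ ; _+_ = _⊕_ ; _*_ = _⊗_ ; -_ = ⊖_ ; 0# = 𝟎 ; 1# = 𝟏
    ; isCommutativeRing = record
      { isRing = record
        { +-isAbelianGroup = record
          { isGroup = record
            { isMonoid = record
              { isSemigroup = record
                { isMagma = record { isEquivalence = isEquivalence ; ∙-cong = cong₂ _⊕_ }
                ; assoc = +F-assoc }
              ; identity = +F-identityˡ , +F-identityʳ }
            ; inverse = +F-inverseˡ , +F-inverseʳ
            ; ⁻¹-cong = cong ⊖_ }
          ; comm = +F-comm }
        ; *-cong = cong₂ _⊗_
        ; *-assoc = *F-assoc
        ; *-identity = *F-identityˡ , *F-identityʳ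
        ; distrib = *F-distribˡ-+F , *F-distribʳ-+F }
      ; *-comm = *F-comm } }

  open CommutativeRing commutativeRing public using (zeroˡ; zeroʳ)
  open Algebra.Properties.Ring (CommutativeRing.ring commutativeRing) public
    using (-1*x≈-x; -‿distribˡ-*; -‿distribʳ-*; x[y-z]≈xy-xz)
    renaming (x∙y⁻¹≈ε⇒x≈y to a-b≡0⇒a≡b; -‿involutive to ⊖-involutive; -‿+-comm to ⊖-+-comm; -0#≈0# to ⊖0≡0; +-cancelʳ to +F-cancelʳ)

  toℕ-0F : toℕ 𝟎 ≡ 0
  toℕ-0F = trans (toℕ-mod 0) (m<n⇒m%n≡m (ℕ.>-nonZero⁻¹ q))

  double : ∀ a → a ⊕ a ≡ (𝟏 ⊕ 𝟏) ⊗ a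
  double a = sym (trans (*F-distribʳ-+F a 𝟏 𝟏) (cong₂ _⊕_ (*F-identityˡ a) (*F-identityˡ a)))

-- Finite pigeonhole and the prime field

-- If `y` were missed, punching it out of the codomain would inject n + 1 points into n.
injective⇒surjective : ∀ {n} (f : Fin n → Fin n) → Injective _≡_ _≡_ f → ∀ y → ∃[ x ] f x ≡ y
injective⇒surjective {ℕ.suc n} f inj y with any? (λ x → f x ≟ y)
... | yes hit = hit
... | no miss = ⊥-elim (<⇒notInjective {f = λ x → punchOut (avoid x)} (ℕₚ.n<1+n n)
                  (λ {x} {x′} eq → inj (punchOut-injective (avoid x) (avoid x′) eq)))
  where
  avoid : ∀ x → y ≢ f x
  avoid x y≡fx = miss (x , sym y≡fx)

module PrimeField (q : ℕ) .{{_ : NonZero q}} (prime : Prime q) where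

  open ModularArithmetic q public

  noZeroDivisors : ∀ a b → a ⊗ b ≡ 𝟎 → a ≡ 𝟎 ⊎ b ≡ 𝟎
  noZeroDivisors a b ab≡0 = Sum.map (q∣⇒≡0 a) (q∣⇒≡0 b)
    (euclidsLemma (toℕ a) (toℕ b) prime
      (m%n≡0⇒n∣m _ q (trans (sym (toℕ-mod _)) (trans (cong toℕ ab≡0) toℕ-0F))))
    where
    q∣⇒≡0 : ∀ c → q ∣ toℕ c → c ≡ 𝟎
    q∣⇒≡0 c q∣c = toℕ-injective (trans (sym (m<n⇒m%n≡m (toℕ<n c)))
      (trans (n∣m⇒m%n≡0 (toℕ c) q q∣c) (sym toℕ-0F)))

  *F-cancelˡ : ∀ {a} → a ≢ 𝟎 → ∀ {b c} → a ⊗ b ≡ a ⊗ c → b ≡ c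
  *F-cancelˡ {a} a≢0 {b} {c} ab≡ac = a-b≡0⇒a≡b b c
    ([ ⊥-elim ∘ a≢0 , id ] (noZeroDivisors a (b ⊕ ⊖ c) (trans (x[y-z]≈xy-xz a b c)
      (trans (cong (_⊕ ⊖ (a ⊗ c)) ab≡ac) (+F-inverseʳ (a ⊗ c))))))

  abstract
    inverse : ∀ {a} → a ≢ 𝟎 → ∃[ b ] b ⊗ a ≡ 𝟏
    inverse {a} a≢0 = let b , ab≡1 = injective⇒surjective (a ⊗_) (*F-cancelˡ a≢0) 𝟏
                      in b , trans (*F-comm b a) ab≡1

  1≢0 : 𝟏 ≢ 𝟎
  1≢0 1≡0 = ℕₚ.1+n≢0 (trans (sym (trans (toℕ-mod 1) (m<n⇒m%n≡m (ℕ.nonTrivial⇒n>1 q {{prime⇒nonTrivial prime}}))))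
    (trans (cong toℕ 1≡0) toℕ-0F))

  -- Here `q ≥ 3` excludes characteristic 2. The inverse of 2 is what later isolates the squares in
  -- the span of the code.
  half : 3 ≤ q → ∃[ h ] h ⊕ h ≡ 𝟏
  half 3≤q = let h , h2≡1 = inverse 2≢0 in h , trans (double h) (trans (*F-comm _ h) h2≡1)
    where
    2≢0 : 𝟏 ⊕ 𝟏 ≢ 𝟎
    2≢0 2≡0 = ℕₚ.1+n≢0 (trans (sym (trans (cong toℕ (mod-+ 1 1)) (trans (toℕ-mod 2) (m<n⇒m%n≡m 3≤q))))
      (trans (cong toℕ 2≡0) toℕ-0F))

-- Vectors, linear combinations and spans

lookup-ext : ∀ {A : Set} {n} {u v : Vec A n} → lookup u ≗ lookup v → u ≡ v
lookup-ext {u = u} {v} eq = trans (sym (tabulate∘lookup u)) (trans (tabulate-cong eq) (tabulate∘lookup v))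

module Vectors (q : ℕ) .{{_ : NonZero q}} where

  open ModularArithmetic q

  infixl 6 _+ᵥ_
  infixr 7 _·ᵥ_
  infix 8 -ᵥ_

  _+ᵥ_ : ∀ {m} → Vec (F q) m → Vec (F q) m → Vec (F q) m
  _+ᵥ_ = _+V_ q

  _·ᵥ_ : ∀ {m} → F q → Vec (F q) m → Vec (F q) m
  _·ᵥ_ = _·V_ q

  -ᵥ_ : ∀ {m} → Vec (F q) m → Vec (F q) m
  -ᵥ_ = map ⊖_

  0ᵥ : ∀ {m} → Vec (F q) m
  0ᵥ = 0V q

  +ᵥ-abelianGroup : ℕ → AbelianGroup _ _
  +ᵥ-abelianGroup m = record
    { Carrier = Vec (F q) m ; _≈_ = _≡_ ; _∙_ = _+ᵥ_ ; ε = 0ᵥ ; _⁻¹ = -ᵥ_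
    ; isAbelianGroup = record
      { isGroup = record
        { isMonoid = record
          { isSemigroup = record
            { isMagma = record { isEquivalence = isEquivalence ; ∙-cong = cong₂ _+ᵥ_ }
            ; assoc = zipWith-assoc +F-assoc }
          ; identity = zipWith-identityˡ +F-identityˡ , zipWith-identityʳ +F-identityʳ }
        ; inverse = zipWith-inverseˡ +F-inverseˡ , zipWith-inverseʳ +F-inverseʳ
        ; ⁻¹-cong = cong -ᵥ_ }
      ; comm = zipWith-comm +F-comm } }

  +ᵥ-commutativeMonoid : ℕ → CommutativeMonoid _ _
  +ᵥ-commutativeMonoid m = AbelianGroup.commutativeMonoid (+ᵥ-abelianGroup m)

  module _ {m : ℕ} where

    open AbelianGroup (+ᵥ-abelianGroup m) public using () renaming
      ( assoc to +ᵥ-assoc; comm to +ᵥ-comm; identityˡ to +ᵥ-identityˡ; identityʳ to +ᵥ-identityʳ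
      ; inverseˡ to +ᵥ-inverseˡ; inverseʳ to +ᵥ-inverseʳ )
    open Algebra.Properties.AbelianGroup (+ᵥ-abelianGroup m) public using () renaming
      ( ∙-cancelˡ to +ᵥ-cancelˡ; ∙-cancelʳ to +ᵥ-cancelʳ; inverseʳ-unique to -ᵥ-uniqueʳ
      ; ⁻¹-∙-comm to -ᵥ-+ᵥ-comm
      ; ε⁻¹≈ε to -ᵥ0≡0
      ; //-rightDividesˡ to x-y+y≡x; //-rightDividesʳ to x+y-y≡x)
    open Algebra.Properties.CommutativeSemigroup
      (AbelianGroup.commutativeSemigroup (+ᵥ-abelianGroup m)) public using () renaming
      ( interchange to +ᵥ-interchange )

  ·ᵥ-distribˡ : ∀ {m} c (u v : Vec (F q) m) → c ·ᵥ (u +ᵥ v) ≡ c ·ᵥ u +ᵥ c ·ᵥ v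
  ·ᵥ-distribˡ c []      []      = refl
  ·ᵥ-distribˡ c (a ∷ u) (b ∷ v) = cong₂ _∷_ (*F-distribˡ-+F c a b) (·ᵥ-distribˡ c u v)

  ·ᵥ-distribʳ : ∀ {m} c d (u : Vec (F q) m) → (c ⊕ d) ·ᵥ u ≡ c ·ᵥ u +ᵥ d ·ᵥ u
  ·ᵥ-distribʳ c d []      = refl
  ·ᵥ-distribʳ c d (a ∷ u) = cong₂ _∷_ (*F-distribʳ-+F a c d) (·ᵥ-distribʳ c d u)

  ·ᵥ-assoc : ∀ {m} c d (u : Vec (F q) m) → (c ⊗ d) ·ᵥ u ≡ c ·ᵥ d ·ᵥ u
  ·ᵥ-assoc c d []      = refl
  ·ᵥ-assoc c d (a ∷ u) = cong₂ _∷_ (*F-assoc c d a) (·ᵥ-assoc c d u)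

  ·ᵥ-identity : ∀ {m} (u : Vec (F q) m) → 𝟏 ·ᵥ u ≡ u
  ·ᵥ-identity []      = refl
  ·ᵥ-identity (a ∷ u) = cong₂ _∷_ (*F-identityˡ a) (·ᵥ-identity u)

  ·ᵥ-zeroˡ : ∀ {m} (u : Vec (F q) m) → 𝟎 ·ᵥ u ≡ 0ᵥ
  ·ᵥ-zeroˡ []      = refl
  ·ᵥ-zeroˡ (a ∷ u) = cong₂ _∷_ (zeroˡ a) (·ᵥ-zeroˡ u)

  ·ᵥ-zeroʳ : ∀ {m} c → c ·ᵥ 0ᵥ {m} ≡ 0ᵥ
  ·ᵥ-zeroʳ {ℕ.zero}  c = refl
  ·ᵥ-zeroʳ {ℕ.suc m} c = cong₂ _∷_ (zeroʳ c) (·ᵥ-zeroʳ c)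

  -1·ᵥ : ∀ {m} (u : Vec (F q) m) → (⊖ 𝟏) ·ᵥ u ≡ -ᵥ u
  -1·ᵥ []      = refl
  -1·ᵥ (a ∷ u) = cong₂ _∷_ (-1*x≈-x a) (-1·ᵥ u)

  ·ᵥ-interchange : ∀ {m} c (u v w z : Vec (F q) m) →
    c ·ᵥ (u +ᵥ v) +ᵥ (w +ᵥ z) ≡ (c ·ᵥ u +ᵥ w) +ᵥ (c ·ᵥ v +ᵥ z)
  ·ᵥ-interchange c u v w z = trans (cong (_+ᵥ (w +ᵥ z)) (·ᵥ-distribˡ c u v)) (+ᵥ-interchange _ _ _ _)

  -- Additivity and homogeneity in one equation, so that each map needs a single induction; the
  -- usual laws follow below.
  Linear : ∀ {m n} → (Vec (F q) m → Vec (F q) n) → Set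
  Linear f = ∀ c u v → f (c ·ᵥ u +ᵥ v) ≡ c ·ᵥ f u +ᵥ f v

  module _ {m n} {f : Vec (F q) m → Vec (F q) n} (lin : Linear f) where

    linear-+ : ∀ u v → f (u +ᵥ v) ≡ f u +ᵥ f v
    linear-+ u v = trans (cong (λ w → f (w +ᵥ v)) (sym (·ᵥ-identity u)))
      (trans (lin 𝟏 u v) (cong (_+ᵥ f v) (·ᵥ-identity (f u))))

    linear-0 : f 0ᵥ ≡ 0ᵥ
    linear-0 = +ᵥ-cancelˡ (f 0ᵥ) _ _
      (trans (sym (linear-+ 0ᵥ 0ᵥ)) (trans (cong f (+ᵥ-identityˡ 0ᵥ)) (sym (+ᵥ-identityʳ (f 0ᵥ)))))

    linear-· : ∀ c u → f (c ·ᵥ u) ≡ c ·ᵥ f u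
    linear-· c u = trans (cong f (sym (+ᵥ-identityʳ (c ·ᵥ u))))
      (trans (lin c u 0ᵥ) (trans (cong (c ·ᵥ f u +ᵥ_) linear-0) (+ᵥ-identityʳ _)))

    linear-neg : ∀ u → f (-ᵥ u) ≡ -ᵥ f u
    linear-neg u = trans (cong f (sym (-1·ᵥ u))) (trans (linear-· (⊖ 𝟏) u) (-1·ᵥ (f u)))

  linear-∘ : ∀ {k m n} {f : Vec (F q) m → Vec (F q) n} {g : Vec (F q) k → Vec (F q) m} →
    Linear f → Linear g → Linear (f ∘ g)
  linear-∘ {f = f} {g} lf lg c u v = trans (cong f (lg c u v)) (lf c (g u) (g v))

  tail-linear : ∀ {m} → Linear {ℕ.suc m} tail
  tail-linear c (_ ∷ _) (_ ∷ _) = refl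

  head-linear : ∀ {m} c (u v : Vec (F q) (ℕ.suc m)) → head (c ·ᵥ u +ᵥ v) ≡ c ⊗ head u ⊕ head v
  head-linear c (_ ∷ _) (_ ∷ _) = refl

  take-linear : ∀ m {n} → Linear {m + n} (take m)
  take-linear ℕ.zero    c u       v       = refl
  take-linear (ℕ.suc m) c (a ∷ u) (b ∷ v) = cong (_ ∷_) (take-linear m c u v)

  drop-linear : ∀ m {n} → Linear {m + n} (drop m)
  drop-linear ℕ.zero    c u       v       = refl
  drop-linear (ℕ.suc m) c (a ∷ u) (b ∷ v) = drop-linear m c u v

  lincomb-linear : ∀ {k m} (w : Vec (Vec (F q) m) k) → Linear (λ c → lincomb q c w)
  lincomb-linear []      c []      []      = sym (trans (+ᵥ-identityʳ _) (·ᵥ-zeroʳ c))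
  lincomb-linear (w ∷ ws) c (x ∷ xs) (y ∷ ys) = trans
    (cong₂ _+ᵥ_ (trans (·ᵥ-distribʳ (c ⊗ x) y w) (cong (_+ᵥ y ·ᵥ w) (·ᵥ-assoc c x w)))
                (lincomb-linear ws c xs ys))
    (trans (+ᵥ-interchange _ _ _ _)
      (cong (_+ᵥ (y ·ᵥ w +ᵥ lincomb q ys ws)) (sym (·ᵥ-distribˡ c _ _))))

  lincomb-map : ∀ {k m n} {f : Vec (F q) m → Vec (F q) n} → Linear f →
    ∀ (c : Vec (F q) k) w → f (lincomb q c w) ≡ lincomb q c (map f w)
  lincomb-map lin []      []       = linear-0 lin
  lincomb-map {f = f} lin (c ∷ cs) (w ∷ ws) =
    trans (lin c w _) (cong (c ·ᵥ f w +ᵥ_) (lincomb-map lin cs ws))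

  lincomb-++ : ∀ {k l m} (c : Vec (F q) k) (d : Vec (F q) l) (w : Vec (Vec (F q) m) k) z →
    lincomb q (c ++ d) (w ++ z) ≡ lincomb q c w +ᵥ lincomb q d z
  lincomb-++ []      d []      z = sym (+ᵥ-identityˡ _)
  lincomb-++ (c ∷ cs) d (w ∷ ws) z = trans (cong (c ·ᵥ w +ᵥ_) (lincomb-++ cs d ws z)) (sym (+ᵥ-assoc _ _ _))

  lincomb-zeros : ∀ {k m} (w : Vec (Vec (F q) m) k) → lincomb q 0ᵥ w ≡ 0ᵥ
  lincomb-zeros w = linear-0 (lincomb-linear w)

  module Sumᵥ {m : ℕ} = Algebra.Properties.CommutativeMonoid.Sum (+ᵥ-commutativeMonoid m)

  -- Sums indexed by `Fin` may be permuted, which is how a permutation of coordinates is shifted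
  -- onto the columns.
  lincomb-sum : ∀ {k m} (c : Vec (F q) k) (w : Vec (Vec (F q) m) k) →
    lincomb q c w ≡ Sumᵥ.sum (λ j → lookup c j ·ᵥ lookup w j)
  lincomb-sum []       []       = refl
  lincomb-sum (c ∷ cs) (w ∷ ws) = cong (c ·ᵥ w +ᵥ_) (lincomb-sum cs ws)

  -- Recursive, unlike `unit`, so that selecting a column is an induction on the position.
  e⟨_⟩ : ∀ {k} → Fin k → Vec (F q) k
  e⟨ Fin.zero ⟩  = 𝟏 ∷ 0ᵥ
  e⟨ Fin.suc j ⟩ = 𝟎 ∷ e⟨ j ⟩

  lincomb-e⟨⟩ : ∀ {k m} (j : Fin k) (w : Vec (Vec (F q) m) k) → lincomb q e⟨ j ⟩ w ≡ lookup w j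
  lincomb-e⟨⟩ Fin.zero    (w ∷ ws) = trans (cong₂ _+ᵥ_ (·ᵥ-identity w) (lincomb-zeros ws)) (+ᵥ-identityʳ w)
  lincomb-e⟨⟩ (Fin.suc j) (w ∷ ws) = trans (cong₂ _+ᵥ_ (·ᵥ-zeroˡ w) (lincomb-e⟨⟩ j ws)) (+ᵥ-identityˡ _)

  -- The conditional has the shape of an entry of `unit`, with which `e⟨_⟩` is identified later.
  lookup-e⟨⟩ : ∀ {k} (i j : Fin k) → lookup e⟨ i ⟩ j ≡ (if ⌊ i ≟ j ⌋ then 𝟏 else 𝟎)
  lookup-e⟨⟩ Fin.zero    Fin.zero    = refl
  lookup-e⟨⟩ Fin.zero    (Fin.suc j) = lookup-replicate j 𝟎
  lookup-e⟨⟩ (Fin.suc i) Fin.zero    = refl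
  lookup-e⟨⟩ (Fin.suc i) (Fin.suc j) with i ≟ j | lookup-e⟨⟩ i j
  ... | yes _ | eq = eq
  ... | no _  | eq = eq

  standardBasis : ∀ k → Vec (Vec (F q) k) k
  standardBasis ℕ.zero    = []
  standardBasis (ℕ.suc k) = (𝟏 ∷ 0ᵥ) ∷ map (𝟎 ∷_) (standardBasis k)

  lincomb-standardBasis : ∀ {k} (c : Vec (F q) k) → lincomb q c (standardBasis k) ≡ c
  lincomb-standardBasis [] = refl
  lincomb-standardBasis (c ∷ cs) = trans
    (cong (c ·ᵥ (𝟏 ∷ 0ᵥ) +ᵥ_) (trans (sym (lincomb-map 0∷-linear cs _)) (cong (𝟎 ∷_) (lincomb-standardBasis cs))))
    (cong₂ _∷_ (trans (+F-identityʳ _) (*F-identityʳ c)) (trans (cong (_+ᵥ cs) (·ᵥ-zeroʳ c)) (+ᵥ-identityˡ cs)))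
    where
    0∷-linear : ∀ {m} → Linear {m} (𝟎 ∷_)
    0∷-linear c u v = cong (_∷ (c ·ᵥ u +ᵥ v)) (sym (trans (+F-identityʳ _) (zeroʳ c)))

  InSpan-closed : ∀ {ℓ N} {Sc : Vec (F q) N → Set ℓ} c {u v} →
    InSpan q Sc u → InSpan q Sc v → InSpan q Sc (c ·ᵥ u +ᵥ v)
  InSpan-closed c (m , a , w , Sw , aw≡u) (n , b , z , Sz , bz≡v) =
    m + n , c ·ᵥ a ++ b , w ++ z , All.++⁺ Sw Sz ,
    trans (lincomb-++ (c ·ᵥ a) b w z)
      (cong₂ _+ᵥ_ (trans (linear-· (lincomb-linear w) c a) (cong (c ·ᵥ_) aw≡u)) bz≡v)

  InSpan-∈ : ∀ {ℓ N} {Sc : Vec (F q) N → Set ℓ} {v} → Sc v → InSpan q Sc v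
  InSpan-∈ {v = v} Sv = 1 , 𝟏 ∷ [] , v ∷ [] , Sv All.∷ All.[] , trans (+ᵥ-identityʳ _) (·ᵥ-identity v)

-- Bases of kernels, with exact dimensions

module Kernels (q : ℕ) .{{_ : NonZero q}} (prime : Prime q) where

  open PrimeField q prime
  open Vectors q

  IsSpanned : ∀ {k N} → Vec (Vec (F q) N) k → Vec (F q) N → Set
  IsSpanned b v = ∃[ c ] lincomb q c b ≡ v

  module _ {N} {f : Vec (F q) N → F q} (lin : ∀ c u v → f (c ·ᵥ u +ᵥ v) ≡ c ⊗ f u ⊕ f v) where

    functional-0 : f 0ᵥ ≡ 𝟎
    functional-0 = begin
      f 0ᵥ                    ≡⟨ cong f (trans (cong (_+ᵥ 0ᵥ) (·ᵥ-zeroʳ (⊖ 𝟏))) (+ᵥ-identityˡ 0ᵥ)) ⟨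
      f ((⊖ 𝟏) ·ᵥ 0ᵥ +ᵥ 0ᵥ)   ≡⟨ lin (⊖ 𝟏) 0ᵥ 0ᵥ ⟩
      ⊖ 𝟏 ⊗ f 0ᵥ ⊕ f 0ᵥ       ≡⟨ cong (_⊕ f 0ᵥ) (-1*x≈-x (f 0ᵥ)) ⟩
      ⊖ f 0ᵥ ⊕ f 0ᵥ           ≡⟨ +F-inverseˡ (f 0ᵥ) ⟩
      𝟎                       ∎
      where open ≡-Reasoning

    lincomb-vanishes : ∀ {k} {A : Set} (g : A → Vec (F q) N) → (∀ a → f (g a) ≡ 𝟎) →
      ∀ (c : Vec (F q) k) as → f (lincomb q c (map g as)) ≡ 𝟎
    lincomb-vanishes g fg≡0 []       []       = functional-0
    lincomb-vanishes g fg≡0 (c ∷ cs) (a ∷ as) = trans (lin c (g a) _)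
      (trans (cong₂ _⊕_ (trans (cong (c ⊗_) (fg≡0 a)) (zeroʳ c)) (lincomb-vanishes g fg≡0 cs as)) (+F-identityˡ 𝟎))

    private
      -- `b′` is a basis of the intersection of `span b` with the kernel of `f`. Working relative to
      -- `b` allows functionals to be imposed one after another.
      KernelBasis : ∀ {k l} → Vec (Vec (F q) N) k → Vec (Vec (F q) N) l → Set
      KernelBasis b b′ = LinIndep q b′
        × (∀ c → f (lincomb q c b′) ≡ 𝟎 × IsSpanned b (lincomb q c b′))
        × (∀ v → IsSpanned b v → f v ≡ 𝟎 → IsSpanned b′ v)

    module _ (p : Vec (F q) N) (ι : F q) (ιfp≡1 : ι ⊗ f p ≡ 𝟏) (fp≢0 : f p ≢ 𝟎) where

      -- The projection onto the kernel of `f` along the pivot `p`; `ι` is the inverse of `f p`.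
      reduce : Vec (F q) N → Vec (F q) N
      reduce u = (⊖ (f u ⊗ ι)) ·ᵥ p +ᵥ u

      f-reduce : ∀ u → f (reduce u) ≡ 𝟎
      f-reduce u = begin
        f (reduce u)                  ≡⟨ lin (⊖ (f u ⊗ ι)) p u ⟩
        ⊖ (f u ⊗ ι) ⊗ f p ⊕ f u       ≡⟨ cong (_⊕ f u) (-‿distribˡ-* (f u ⊗ ι) (f p)) ⟨
        ⊖ (f u ⊗ ι ⊗ f p) ⊕ f u       ≡⟨ cong (λ a → ⊖ a ⊕ f u) (*F-assoc (f u) ι (f p)) ⟩
        ⊖ (f u ⊗ (ι ⊗ f p)) ⊕ f u     ≡⟨ cong (λ a → ⊖ (f u ⊗ a) ⊕ f u) ιfp≡1 ⟩
        ⊖ (f u ⊗ 𝟏) ⊕ f u             ≡⟨ cong (λ a → ⊖ a ⊕ f u) (*F-identityʳ (f u)) ⟩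
        ⊖ f u ⊕ f u                   ≡⟨ +F-inverseˡ (f u) ⟩
        𝟎                             ∎
        where open ≡-Reasoning

      -- Projecting changes a combination only by some multiple of `p`. Its value `γ` may stay
      -- unspecified, since `f` determines it when needed.
      lincomb-reduce : ∀ {k} (c : Vec (F q) k) b →
        ∃[ γ ] lincomb q c (map reduce b) ≡ γ ·ᵥ p +ᵥ lincomb q c b
      lincomb-reduce []       []      = 𝟎 , sym (trans (+ᵥ-identityʳ _) (·ᵥ-zeroˡ p))
      lincomb-reduce (c ∷ cs) (u ∷ b) = let γ , eq = lincomb-reduce cs b in
        c ⊗ ⊖ (f u ⊗ ι) ⊕ γ , (begin
        c ·ᵥ reduce u +ᵥ lincomb q cs (map reduce b)
          ≡⟨ cong (c ·ᵥ reduce u +ᵥ_) eq ⟩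
        c ·ᵥ reduce u +ᵥ (γ ·ᵥ p +ᵥ lincomb q cs b)
          ≡⟨ ·ᵥ-interchange c _ u _ _ ⟩
        (c ·ᵥ (⊖ (f u ⊗ ι)) ·ᵥ p +ᵥ γ ·ᵥ p) +ᵥ (c ·ᵥ u +ᵥ lincomb q cs b)
          ≡⟨ cong (λ w → (w +ᵥ γ ·ᵥ p) +ᵥ _) (·ᵥ-assoc c _ p) ⟨
        ((c ⊗ ⊖ (f u ⊗ ι)) ·ᵥ p +ᵥ γ ·ᵥ p) +ᵥ (c ·ᵥ u +ᵥ lincomb q cs b)
          ≡⟨ cong (_+ᵥ _) (·ᵥ-distribʳ _ γ p) ⟨
        (c ⊗ ⊖ (f u ⊗ ι) ⊕ γ) ·ᵥ p +ᵥ (c ·ᵥ u +ᵥ lincomb q cs b) ∎)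
        where open ≡-Reasoning

      -- One step of Gaussian elimination with pivot `p`: a relation among the projected vectors
      -- extends to a relation on `p ∷ b` by the coefficient `γ`.
      reduce-basis : ∀ {k} (b : Vec (Vec (F q) N) k) → LinIndep q (p ∷ b) → KernelBasis (p ∷ b) (map reduce b)
      reduce-basis b indep =
          (λ c eq → cong tail (indep (proj₁ (lincomb-reduce c b) ∷ c) (trans (sym (proj₂ (lincomb-reduce c b))) eq)))
        , (λ c → lincomb-vanishes reduce f-reduce c b , (let γ , eq = lincomb-reduce c b in γ ∷ c , sym eq))
        , spanning
        where
        spanning : ∀ v → IsSpanned (p ∷ b) v → f v ≡ 𝟎 → IsSpanned (map reduce b) v
        -- The coefficients `c` serve unchanged: `f` is zero on both vectors and nonzero on `p`, so
        -- the multiples `γ` and `d` of `p` agree.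
        spanning v (d ∷ c , refl) fv≡0 = let γ , eq = lincomb-reduce c b in
          c , trans eq (cong (λ a → a ·ᵥ p +ᵥ lincomb q c b) (*F-cancelˡ fp≢0
            (trans (*F-comm _ γ) (trans (+F-cancelʳ (f (lincomb q c b)) (γ ⊗ f p) (d ⊗ f p) (begin
              γ ⊗ f p ⊕ f (lincomb q c b)          ≡⟨ lin γ p _ ⟨
              f (γ ·ᵥ p +ᵥ lincomb q c b)          ≡⟨ cong f eq ⟨
              f (lincomb q c (map reduce b))       ≡⟨ lincomb-vanishes reduce f-reduce c b ⟩
              𝟎                                    ≡⟨ fv≡0 ⟨
              f (d ·ᵥ p +ᵥ lincomb q c b)          ≡⟨ lin d p _ ⟩
              d ⊗ f p ⊕ f (lincomb q c b)          ∎)) (*F-comm d _)))))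
          where open ≡-Reasoning

    -- Searches for a pivot. Vectors on which `f` vanishes are kept and passed by; they do not
    -- affect `f`, so `nz` descends to the rest and guarantees that a pivot is met. Exactly one
    -- vector is lost.
    functional-kernel : ∀ {k} (b : Vec (Vec (F q) N) (ℕ.suc k)) → LinIndep q b →
      ∀ c → f (lincomb q c b) ≢ 𝟎 → ∃[ b′ ] KernelBasis {l = k} b b′
    functional-kernel (p ∷ b) indep c nz with f p ≟ 𝟎
    ... | no fp≢0 = let ι , ιfp≡1 = inverse fp≢0 in _ , reduce-basis p ι ιfp≡1 fp≢0 b indep
    functional-kernel (p ∷ []) indep (c ∷ []) nz | yes fp≡0 =
      ⊥-elim (nz (trans (lin c p 0ᵥ) (trans (cong₂ _⊕_ (trans (cong (c ⊗_) fp≡0) (zeroʳ c)) functional-0) (+F-identityˡ 𝟎))))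
    functional-kernel (p ∷ b@(_ ∷ _)) indep (c ∷ cs) nz | yes fp≡0 =
      let b′ , indep′ , inKernel , spanning = functional-kernel b
            (λ d eq → cong tail (indep (𝟎 ∷ d) (trans (cong₂ _+ᵥ_ (·ᵥ-zeroˡ p) eq) (+ᵥ-identityˡ 0ᵥ))))
            cs (λ eq → nz (trans (f-p c _) eq))
      in p ∷ b′
       , (λ { (d ∷ ds) eq → let es , es-eq = proj₂ (inKernel ds)
                                d≡0 = proj₁ (∷-injective (indep (d ∷ es) (trans (cong (d ·ᵥ p +ᵥ_) es-eq) eq)))
              in cong₂ _∷_ d≡0 (indep′ ds (trans (sym (trans (cong (_+ᵥ _) (trans (cong (_·ᵥ p) d≡0) (·ᵥ-zeroˡ p))) (+ᵥ-identityˡ _))) eq)) })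
       , (λ { (d ∷ ds) → let fds≡0 , es , es-eq = inKernel ds in
              trans (f-p d _) fds≡0 , d ∷ es , cong (d ·ᵥ p +ᵥ_) es-eq })
       , (λ { v (d ∷ ds , refl) fv≡0 → let es , es-eq = spanning _ (ds , refl) (trans (sym (f-p d _)) fv≡0) in
              d ∷ es , cong (d ·ᵥ p +ᵥ_) es-eq })
      where
      f-p : ∀ d u → f (d ·ᵥ p +ᵥ u) ≡ f u
      f-p d u = trans (lin d p u) (trans (cong (_⊕ f u) (trans (cong (d ⊗_) fp≡0) (zeroʳ d))) (+F-identityˡ (f u)))

  -- Rank-nullity by imposing the coordinates of `κ` one at a time. Surjectivity makes each of them
  -- lower the dimension by exactly one.
  kernel-basis : ∀ {k N} s (κ : Vec (F q) N → Vec (F q) s) → Linear κ → (∀ a → ∃[ v ] κ v ≡ a) → s + k ≡ N →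
    Σ (Vec (Vec (F q) N) k) λ b → LinIndep q b × (∀ c → κ (lincomb q c b) ≡ 0ᵥ) × (∀ v → κ v ≡ 0ᵥ → IsSpanned b v)
  kernel-basis ℕ.zero κ lin surj refl =
      standardBasis _
    , (λ c eq → trans (sym (lincomb-standardBasis c)) eq)
    , (λ c → empty (κ _))
    , (λ v _ → v , lincomb-standardBasis v)
    where
    empty : (u : Vec (F q) 0) → u ≡ 0ᵥ
    empty [] = refl
  kernel-basis {k} (ℕ.suc s) κ lin surj eq =
    let b , indep , inKernel , spanning = kernel-basis s (tail ∘ κ) (linear-∘ tail-linear lin)
          (λ a → let v , κv≡0a = surj (𝟎 ∷ a) in v , cong tail κv≡0a) (trans (ℕₚ.+-suc s k) eq)
        -- `v` lies in the kernel of the remaining coordinates and has head 1, so the head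
        -- functional is nonzero there.
        v , κv≡10 = surj (𝟏 ∷ 0ᵥ)
        c , cb≡v = spanning v (cong tail κv≡10)
        b′ , indep′ , inKernel′ , spanning′ = functional-kernel
          (λ c u v → trans (cong head (lin c u v)) (head-linear c (κ u) (κ v))) b indep c
          (λ eq → 1≢0 (trans (sym (cong head κv≡10)) (trans (cong (head ∘ κ) (sym cb≡v)) eq)))
    in b′ , indep′
     , (λ c → let hd , d , eq = inKernel′ c in
              split (κ _) hd (trans (cong (tail ∘ κ) (sym eq)) (inKernel d)))
     , (λ v κv≡0 → spanning′ v (spanning v (cong tail κv≡0)) (cong head κv≡0))
    where
    split : (u : Vec (F q) (ℕ.suc s)) → head u ≡ 𝟎 → tail u ≡ 0ᵥ → u ≡ 0ᵥ
    split (_ ∷ _) = cong₂ _∷_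

-- Translations and monomial maps as Hamming isometries

module Isometries (q : ℕ) .{{_ : NonZero q}} where

  open ModularArithmetic q
  open Vectors q
  open Algebra.Properties.CommutativeMonoid.Sum ℕₚ.+-0-commutativeMonoid using (sum; sum-permute; sum-cong-≗)

  δ : F q → F q → ℕ
  δ a b = if ⌊ a ≟ b ⌋ then 0 else 1

  δ-injective : ∀ {f : F q → F q} → (∀ {a b} → f a ≡ f b → a ≡ b) → ∀ a b → δ (f a) (f b) ≡ δ a b
  δ-injective {f} inj a b with f a ≟ f b | a ≟ b
  ... | yes _  | yes _  = refl
  ... | no _   | no _   = refl
  ... | yes eq | no a≢b = ⊥-elim (a≢b (inj eq))
  ... | no neq | yes eq = ⊥-elim (neq (cong f eq))

  dH-sum : ∀ {N} (u v : Vec (F q) N) → dH q u v ≡ sum (λ k → δ (lookup u k) (lookup v k))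
  dH-sum []      []      = refl
  dH-sum (a ∷ u) (b ∷ v) = cong (δ a b +_) (dH-sum u v)

  dH-++ : ∀ {m n} (x x′ : Vec (F q) m) (y y′ : Vec (F q) n) →
    dH q (x ++ y) (x′ ++ y′) ≡ dH q x x′ + dH q y y′
  dH-++ []      []        y y′ = refl
  dH-++ (a ∷ x) (a′ ∷ x′) y y′ = trans (cong (δ a a′ +_) (dH-++ x x′ y y′)) (sym (ℕₚ.+-assoc (δ a a′) _ _))

  dH-translate : ∀ {N} (u v w : Vec (F q) N) → dH q (u +ᵥ w) (v +ᵥ w) ≡ dH q u v
  dH-translate []      []      []      = refl
  dH-translate (a ∷ u) (b ∷ v) (c ∷ w) =
    cong₂ _+_ (δ-injective {f = _⊕ c} (λ {x} {y} → +F-cancelʳ c x y) a b) (dH-translate u v w)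

  -- A cancellable factor preserves whether two entries agree, and the permutation only reorders the
  -- count of disagreements.
  monomial-isometry : ∀ {N} (σ : Permutation′ N) (μ : Fin N → F q) → (∀ k {a b} → μ k ⊗ a ≡ μ k ⊗ b → a ≡ b) →
    IsIsometry q (λ z → tabulate (λ k → μ k ⊗ lookup z (σ ⟨$⟩ʳ k)))
  monomial-isometry σ μ inj u v = begin
    dH q (M u) (M v)                                     ≡⟨ dH-sum (M u) (M v) ⟩
    sum (λ k → δ (lookup (M u) k) (lookup (M v) k))      ≡⟨ sum-cong-≗ (λ k → trans
        (cong₂ δ (lookup∘tabulate _ k) (lookup∘tabulate _ k)) (δ-injective {f = μ k ⊗_} (inj k) _ _)) ⟩
    sum (λ k → δ (lookup u (σ ⟨$⟩ʳ k)) (lookup v (σ ⟨$⟩ʳ k))) ≡⟨ sum-permute (λ k → δ (lookup u k) (lookup v k)) σ ⟨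
    sum (λ k → δ (lookup u k) (lookup v k))              ≡⟨ dH-sum u v ⟨
    dH q u v                                             ∎
    where
    open ≡-Reasoning
    M : Vec (F q) _ → Vec (F q) _
    M z = tabulate (λ k → μ k ⊗ lookup z (σ ⟨$⟩ʳ k))

-- Representations and their monomial lifts

-- A linear representation of the additive group of `F_q^r` on `F_q^m`. Invertibility comes for free
-- from the action of `-ᵥ p`.
record LinearAction (q : ℕ) .{{_ : NonZero q}} (r m : ℕ) : Set where
  open Vectors q
  field
    act    : Vec (F q) r → Vec (F q) m → Vec (F q) m
    linear : ∀ p → Linear (act p)
    act-0  : ∀ v → act 0ᵥ v ≡ v
    act-+  : ∀ p p′ v → act (p +ᵥ p′) v ≡ act p (act p′ v)

  act-inverseʳ : ∀ p v → act p (act (-ᵥ p) v) ≡ v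
  act-inverseʳ p v = trans (sym (act-+ p (-ᵥ p) v)) (trans (cong (λ p → act p v) (+ᵥ-inverseʳ p)) (act-0 v))

  act-inverseˡ : ∀ p v → act (-ᵥ p) (act p v) ≡ v
  act-inverseˡ p v = trans (sym (act-+ (-ᵥ p) p v)) (trans (cong (λ p → act p v) (+ᵥ-inverseˡ p)) (act-0 v))

module Scaling (q : ℕ) .{{_ : NonZero q}} (prime : Prime q) where

  open PrimeField q prime
  open Vectors q

  -- If `a` and `b` differed, every entry of `v` would have to vanish.
  ·ᵥ-cancelʳ : ∀ {k} (a b : F q) (v : Vec (F q) k) → v ≢ 0ᵥ → a ·ᵥ v ≡ b ·ᵥ v → a ≡ b
  ·ᵥ-cancelʳ a b v v≢0 eq with a ≟ b
  ... | yes a≡b = a≡b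
  ... | no a≢b  = ⊥-elim (v≢0 (vanish v eq))
    where
    vanish : ∀ {k} (v : Vec (F q) k) → a ·ᵥ v ≡ b ·ᵥ v → v ≡ 0ᵥ
    vanish []      _  = refl
    vanish (c ∷ v) eq with c ≟ 𝟎
    ... | yes c≡0 = cong₂ _∷_ c≡0 (vanish v (proj₂ (∷-injective eq)))
    ... | no c≢0  = ⊥-elim (a≢b (*F-cancelˡ c≢0
      (trans (*F-comm c a) (trans (proj₁ (∷-injective eq)) (*F-comm b c)))))

  ·ᵥ-solve : ∀ {k} a b → a ≢ 𝟎 → {u v : Vec (F q) k} → a ·ᵥ u ≡ b ·ᵥ v → ∃[ c ] u ≡ c ·ᵥ v
  ·ᵥ-solve a b a≢0 {u} {v} eq = let ι , ιa≡1 = inverse a≢0 in ι ⊗ b , (begin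
    u               ≡⟨ ·ᵥ-identity u ⟨
    𝟏 ·ᵥ u          ≡⟨ cong (_·ᵥ u) ιa≡1 ⟨
    (ι ⊗ a) ·ᵥ u    ≡⟨ ·ᵥ-assoc ι a u ⟩
    ι ·ᵥ a ·ᵥ u     ≡⟨ cong (ι ·ᵥ_) eq ⟩
    ι ·ᵥ b ·ᵥ v     ≡⟨ ·ᵥ-assoc ι b v ⟨
    (ι ⊗ b) ·ᵥ v    ∎)
    where open ≡-Reasoning

module MonomialLift (q : ℕ) .{{_ : NonZero q}} (prime : Prime q) {r m n : ℕ}
  (L : LinearAction q r m) (h : Vec (Vec (F q) m) n) where

  open PrimeField q prime
  open Vectors q
  open Isometries q
  open Scaling q prime
  open LinearAction L

  module _ (check : IsHammingCheck q m n h)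
    (permutesLines : ∀ p k → ∃[ j ] ∃[ ν ] act p (lookup h k) ≡ ν ·ᵥ lookup h j) where

    private
      h≢0 : ∀ j → lookup h j ≢ 0ᵥ
      h≢0 = proj₁ check

      act-injective : ∀ p {u v} → act p u ≡ act p v → u ≡ v
      act-injective p {u} {v} eq = trans (sym (act-inverseˡ p u)) (trans (cong (act (-ᵥ p)) eq) (act-inverseˡ p v))

      scale-nonzero : ∀ p {j k} μ → act p (lookup h j) ≡ μ ·ᵥ lookup h k → μ ≢ 𝟎
      scale-nonzero p {j} {k} _ eq refl = h≢0 j (act-injective p
        (trans eq (trans (·ᵥ-zeroˡ (lookup h k)) (sym (linear-0 (linear p))))))

      abstract
        -- A monomial map is described by output position, so the column sent into the line of
        -- column `k` is needed. It is found by letting `-ᵥ p` act on column `k` and inverting the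
        -- scalar.
        preimage : ∀ p k → ∃[ j ] ∃[ μ ] act p (lookup h j) ≡ μ ·ᵥ lookup h k
        preimage p k = let j , ν , eq = permutesLines (-ᵥ p) k in j ,
          ·ᵥ-solve ν 𝟏 (scale-nonzero (-ᵥ p) ν eq) (begin
            ν ·ᵥ act p (lookup h j)               ≡⟨ linear-· (linear p) ν _ ⟨
            act p (ν ·ᵥ lookup h j)               ≡⟨ cong (act p) eq ⟨
            act p (act (-ᵥ p) (lookup h k))       ≡⟨ act-inverseʳ p _ ⟩
            lookup h k                            ≡⟨ ·ᵥ-identity _ ⟨
            𝟏 ·ᵥ lookup h k                       ∎)
          where open ≡-Reasoning

      π : Vec (F q) r → Fin n → Fin n
      π p k = proj₁ (preimage p k)

      μ : Vec (F q) r → Fin n → F q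
      μ p k = proj₁ (proj₂ (preimage p k))

      act-π : ∀ p k → act p (lookup h (π p k)) ≡ μ p k ·ᵥ lookup h k
      act-π p k = proj₂ (proj₂ (preimage p k))

      -- Two columns sent into the same line are proportional, by injectivity of the action, hence
      -- equal; the scalar is then fixed because columns are nonzero. All functoriality of the lift
      -- rests on this uniqueness.
      preimage-unique : ∀ p {j k} ν → act p (lookup h j) ≡ ν ·ᵥ lookup h k → π p k ≡ j × μ p k ≡ ν
      preimage-unique p {j} {k} ν eq = πpk≡j ,
          ·ᵥ-cancelʳ (μ p k) ν _ (h≢0 k) (trans (sym (act-π p k)) (trans (cong (act p ∘ lookup h) πpk≡j) eq))
        where
        open ≡-Reasoning
        πpk≡j : π p k ≡ j
        πpk≡j = let c , hk≡c·act = ·ᵥ-solve ν 𝟏 (scale-nonzero p ν eq) (trans (sym eq) (sym (·ᵥ-identity _))) in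
          proj₂ check (π p k) j (μ p k ⊗ c) (act-injective p (begin
            act p (lookup h (π p k))             ≡⟨ act-π p k ⟩
            μ p k ·ᵥ lookup h k                  ≡⟨ cong (μ p k ·ᵥ_) hk≡c·act ⟩
            μ p k ·ᵥ c ·ᵥ act p (lookup h j)     ≡⟨ ·ᵥ-assoc (μ p k) c _ ⟨
            (μ p k ⊗ c) ·ᵥ act p (lookup h j)    ≡⟨ linear-· (linear p) (μ p k ⊗ c) _ ⟨
            act p ((μ p k ⊗ c) ·ᵥ lookup h j)    ∎))

      preimage-0 : ∀ k → π 0ᵥ k ≡ k × μ 0ᵥ k ≡ 𝟏
      preimage-0 k = preimage-unique 0ᵥ 𝟏 (trans (act-0 _) (sym (·ᵥ-identity _)))

      preimage-+ : ∀ p p′ k → π (p +ᵥ p′) k ≡ π p′ (π p k) × μ (p +ᵥ p′) k ≡ μ p k ⊗ μ p′ (π p k)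
      preimage-+ p p′ k = preimage-unique (p +ᵥ p′) (μ p k ⊗ μ p′ (π p k)) (begin
        act (p +ᵥ p′) (lookup h (π p′ (π p k)))             ≡⟨ act-+ p p′ _ ⟩
        act p (act p′ (lookup h (π p′ (π p k))))            ≡⟨ cong (act p) (act-π p′ (π p k)) ⟩
        act p (μ p′ (π p k) ·ᵥ lookup h (π p k))            ≡⟨ linear-· (linear p) (μ p′ (π p k)) _ ⟩
        μ p′ (π p k) ·ᵥ act p (lookup h (π p k))            ≡⟨ cong (μ p′ (π p k) ·ᵥ_) (act-π p k) ⟩
        μ p′ (π p k) ·ᵥ μ p k ·ᵥ lookup h k                 ≡⟨ ·ᵥ-assoc (μ p′ (π p k)) (μ p k) _ ⟨
        (μ p′ (π p k) ⊗ μ p k) ·ᵥ lookup h k                ≡⟨ cong (_·ᵥ lookup h k) (*F-comm (μ p′ (π p k)) (μ p k)) ⟩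
        (μ p k ⊗ μ p′ (π p k)) ·ᵥ lookup h k                ∎)
        where open ≡-Reasoning

      σ : Vec (F q) r → Permutation′ n
      σ p = permutation (π p) (π (-ᵥ p))
        (λ k → trans (sym (proj₁ (preimage-+ (-ᵥ p) p k)))
          (trans (cong (λ p → π p k) (+ᵥ-inverseˡ p)) (proj₁ (preimage-0 k))))
        (λ k → trans (sym (proj₁ (preimage-+ p (-ᵥ p) k)))
          (trans (cong (λ p → π p k) (+ᵥ-inverseʳ p)) (proj₁ (preimage-0 k))))

    -- The coefficient of column `π p k` moves to column `k` and absorbs the scalar by which the
    -- action maps the one to the other.
    lift : Vec (F q) r → Vec (F q) n → Vec (F q) n
    lift p z = tabulate (λ k → μ p k ⊗ lookup z (π p k))

    lift-isometry : ∀ p → IsIsometry q (lift p)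
    lift-isometry p = monomial-isometry (σ p) (μ p) (λ k → *F-cancelˡ (scale-nonzero p (μ p k) (act-π p k)))

    lift-linear : ∀ p → Linear (lift p)
    lift-linear p c u v = lookup-ext (λ k → begin
      lookup (lift p (c ·ᵥ u +ᵥ v)) k                          ≡⟨ lookup∘tabulate _ k ⟩
      μ p k ⊗ lookup (c ·ᵥ u +ᵥ v) (π p k)                     ≡⟨ cong (μ p k ⊗_) (trans (lookup-zipWith _⊕_ (π p k) (c ·ᵥ u) v)
                                                                    (cong (_⊕ lookup v (π p k)) (lookup-map (π p k) (c ⊗_) u))) ⟩
      μ p k ⊗ (c ⊗ lookup u (π p k) ⊕ lookup v (π p k))        ≡⟨ *F-distribˡ-+F (μ p k) (c ⊗ lookup u (π p k)) (lookup v (π p k)) ⟩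
      μ p k ⊗ (c ⊗ lookup u (π p k)) ⊕ μ p k ⊗ lookup v (π p k)
        ≡⟨ cong (_⊕ μ p k ⊗ lookup v (π p k)) (trans (sym (*F-assoc (μ p k) c (lookup u (π p k))))
             (trans (cong (_⊗ lookup u (π p k)) (*F-comm (μ p k) c)) (*F-assoc c (μ p k) (lookup u (π p k))))) ⟩
      c ⊗ (μ p k ⊗ lookup u (π p k)) ⊕ μ p k ⊗ lookup v (π p k)
        ≡⟨ cong₂ _⊕_ (trans (lookup-map k (c ⊗_) (lift p u)) (cong (c ⊗_) (lookup∘tabulate _ k))) (lookup∘tabulate _ k) ⟨
      lookup (c ·ᵥ lift p u) k ⊕ lookup (lift p v) k           ≡⟨ lookup-zipWith _⊕_ k (c ·ᵥ lift p u) (lift p v) ⟨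
      lookup (c ·ᵥ lift p u +ᵥ lift p v) k                     ∎)
      where open ≡-Reasoning

    lift-0 : ∀ z → lift 0ᵥ z ≡ z
    lift-0 z = lookup-ext (λ k → trans (lookup∘tabulate _ k)
      (trans (cong₂ (λ c j → c ⊗ lookup z j) (proj₂ (preimage-0 k)) (proj₁ (preimage-0 k))) (*F-identityˡ (lookup z k))))

    lift-+ : ∀ p p′ z → lift (p +ᵥ p′) z ≡ lift p (lift p′ z)
    lift-+ p p′ z = lookup-ext (λ k → begin
      lookup (lift (p +ᵥ p′) z) k                                     ≡⟨ lookup∘tabulate _ k ⟩
      μ (p +ᵥ p′) k ⊗ lookup z (π (p +ᵥ p′) k)
        ≡⟨ cong₂ (λ c j → c ⊗ lookup z j) (proj₂ (preimage-+ p p′ k)) (proj₁ (preimage-+ p p′ k)) ⟩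
      μ p k ⊗ μ p′ (π p k) ⊗ lookup z (π p′ (π p k))
        ≡⟨ *F-assoc (μ p k) (μ p′ (π p k)) (lookup z (π p′ (π p k))) ⟩
      μ p k ⊗ (μ p′ (π p k) ⊗ lookup z (π p′ (π p k)))                ≡⟨ cong (μ p k ⊗_) (lookup∘tabulate _ (π p k)) ⟨
      μ p k ⊗ lookup (lift p′ z) (π p k)                              ≡⟨ lookup∘tabulate _ k ⟨
      lookup (lift p (lift p′ z)) k                                   ∎)
      where open ≡-Reasoning

    liftAction : LinearAction q r n
    liftAction = record { act = lift ; linear = lift-linear ; act-0 = lift-0 ; act-+ = lift-+ }

    -- The lift intertwines the syndrome map with the action: term `k` on the left is term `π p k`
    -- of the expanded right-hand side, so the two sums differ by the permutation `σ p`.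
    lincomb-lift : ∀ p z → lincomb q (lift p z) h ≡ act p (lincomb q z h)
    lincomb-lift p z = begin
      lincomb q (lift p z) h                                        ≡⟨ lincomb-sum (lift p z) h ⟩
      sum (λ k → lookup (lift p z) k ·ᵥ lookup h k)                 ≡⟨ sum-cong-≗ term ⟩
      sum (λ k → lookup z (π p k) ·ᵥ lookup (map (act p) h) (π p k))
        ≡⟨ sum-permute (λ k → lookup z k ·ᵥ lookup (map (act p) h) k) (σ p) ⟨
      sum (λ k → lookup z k ·ᵥ lookup (map (act p) h) k)            ≡⟨ lincomb-sum z (map (act p) h) ⟨
      lincomb q z (map (act p) h)                                   ≡⟨ lincomb-map (linear p) z h ⟨
      act p (lincomb q z h)                                         ∎
      where
      open ≡-Reasoning
      open Sumᵥ {m} using (sum; sum-cong-≗; sum-permute)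
      term : ∀ k → lookup (lift p z) k ·ᵥ lookup h k ≡ lookup z (π p k) ·ᵥ lookup (map (act p) h) (π p k)
      term k = begin
        lookup (lift p z) k ·ᵥ lookup h k                     ≡⟨ cong (_·ᵥ lookup h k) (lookup∘tabulate _ k) ⟩
        (μ p k ⊗ lookup z (π p k)) ·ᵥ lookup h k              ≡⟨ cong (_·ᵥ lookup h k) (*F-comm (μ p k) (lookup z (π p k))) ⟩
        (lookup z (π p k) ⊗ μ p k) ·ᵥ lookup h k              ≡⟨ ·ᵥ-assoc (lookup z (π p k)) (μ p k) _ ⟩
        lookup z (π p k) ·ᵥ μ p k ·ᵥ lookup h k               ≡⟨ cong (lookup z (π p k) ·ᵥ_) (act-π p k) ⟨
        lookup z (π p k) ·ᵥ act p (lookup h (π p k))          ≡⟨ cong (lookup z (π p k) ·ᵥ_) (lookup-map (π p k) (act p) h) ⟨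
        lookup z (π p k) ·ᵥ lookup (map (act p) h) (π p k)    ∎

-- Regular groups of affine isometries

module RegularAction (q : ℕ) .{{_ : NonZero q}} {r N : ℕ} (M : LinearAction q r N) where

  open Vectors q
  open Isometries q
  open LinearAction M

  module _ {Sc : Vec (F q) N → Set} {T : Vec (F q) r → Vec (F q) N → Set}
    (isometry : ∀ p → IsIsometry q (act p))
    (Sc⇒T : ∀ {w} → Sc w → ∃[ p ] T p w) (T⇒Sc : ∀ {p w} → T p w → Sc w)
    (T-unique : ∀ {p p′ w} → T p w → T p′ w → p ≡ p′)
    (T-0 : T 0ᵥ 0ᵥ)
    (T-∙ : ∀ {p p′ w z} → T p w → T p′ z → T (p +ᵥ p′) (act p z +ᵥ w))
    (T-⁻¹ : ∀ {p w} → T p w → T (-ᵥ p) (-ᵥ act (-ᵥ p) w)) where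

    private
      t : Vec (F q) r → Vec (F q) N → Vec (F q) N → Vec (F q) N
      t p w z = act p z +ᵥ w

      t-∘ : ∀ p w p′ z x → t p w (t p′ z x) ≡ t (p +ᵥ p′) (t p w z) x
      t-∘ p w p′ z x = begin
        act p (act p′ x +ᵥ z) +ᵥ w              ≡⟨ cong (_+ᵥ w) (linear-+ (linear p) (act p′ x) z) ⟩
        act p (act p′ x) +ᵥ act p z +ᵥ w        ≡⟨ +ᵥ-assoc (act p (act p′ x)) (act p z) w ⟩
        act p (act p′ x) +ᵥ (act p z +ᵥ w)      ≡⟨ cong (_+ᵥ (act p z +ᵥ w)) (act-+ p p′ x) ⟨
        act (p +ᵥ p′) x +ᵥ (act p z +ᵥ w)       ∎
        where open ≡-Reasoning

      t-inverseʳ : ∀ p w x → t p w (t (-ᵥ p) (-ᵥ act (-ᵥ p) w) x) ≡ x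
      t-inverseʳ p w x = begin
        act p (act (-ᵥ p) x +ᵥ -ᵥ act (-ᵥ p) w) +ᵥ w          ≡⟨ cong (_+ᵥ w) (linear-+ (linear p) _ _) ⟩
        act p (act (-ᵥ p) x) +ᵥ act p (-ᵥ act (-ᵥ p) w) +ᵥ w  ≡⟨ cong₂ (λ u v → u +ᵥ v +ᵥ w) (act-inverseʳ p x)
                                                                   (trans (linear-neg (linear p) _) (cong -ᵥ_ (act-inverseʳ p w))) ⟩
        x +ᵥ -ᵥ w +ᵥ w                                        ≡⟨ x-y+y≡x w x ⟩
        x                                                     ∎
        where open ≡-Reasoning

      t-inverseˡ : ∀ p w x → t (-ᵥ p) (-ᵥ act (-ᵥ p) w) (t p w x) ≡ x
      t-inverseˡ p w x = begin
        act (-ᵥ p) (act p x +ᵥ w) +ᵥ -ᵥ act (-ᵥ p) w          ≡⟨ cong (_+ᵥ -ᵥ act (-ᵥ p) w) (linear-+ (linear (-ᵥ p)) _ w) ⟩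
        act (-ᵥ p) (act p x) +ᵥ act (-ᵥ p) w +ᵥ -ᵥ act (-ᵥ p) w ≡⟨ x+y-y≡x (act (-ᵥ p) w) _ ⟩
        act (-ᵥ p) (act p x)                                  ≡⟨ act-inverseˡ p x ⟩
        x                                                     ∎
        where open ≡-Reasoning

      -- Membership up to pointwise equality, because `id` and composites agree with some `t p w`
      -- only pointwise.
      G : (Vec (F q) N → Vec (F q) N) → Set
      G g = ∃[ p ] ∃[ w ] T p w × g ≗ t p w

      G-∘ : ∀ g h → G g → G h → G (g ∘ h)
      G-∘ g h (p , w , Tw , g≗) (p′ , z , Tz , h≗) = p +ᵥ p′ , t p w z , T-∙ Tw Tz ,
        λ x → trans (g≗ (h x)) (trans (cong (t p w) (h≗ x)) (t-∘ p w p′ z x))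

      t-closed : ∀ {p w} → T p w → ∀ {x} → Sc x → Sc (t p w x)
      t-closed Tw Sx = T⇒Sc (T-∙ Tw (proj₂ (Sc⇒T Sx)))

      stabilises : ∀ g → G g → Stabilises q Sc g
      stabilises g (p , w , Tw , g≗) x =
          (λ Sx → subst Sc (sym (g≗ x)) (t-closed Tw Sx))
        , (λ Sgx → subst Sc (t-inverseˡ p w x) (t-closed (T-⁻¹ Tw) (subst Sc (g≗ x) Sgx)))

    isPropelinear : IsPropelinear q Sc
    isPropelinear = G
      , (λ { g Gg@(p , w , _ , g≗) →
             (λ u v → trans (cong₂ (dH q) (g≗ u) (g≗ v)) (trans (dH-translate (act p u) (act p v) w) (isometry p u v)))
             , stabilises g Gg })
      , (0ᵥ , 0ᵥ , T-0 , λ x → sym (trans (+ᵥ-identityʳ _) (act-0 x)))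
      , G-∘
      , (λ { g (p , w , Tw , g≗) → t (-ᵥ p) (-ᵥ act (-ᵥ p) w) , (_ , _ , T-⁻¹ Tw , λ _ → refl) ,
             (λ x → trans (cong (t (-ᵥ p) (-ᵥ act (-ᵥ p) w)) (g≗ x)) (t-inverseˡ p w x)) ,
             (λ x → trans (g≗ _) (t-inverseʳ p w x)) })
      , (λ x y Sx Sy →
           let p , Tx = Sc⇒T Sx
               p′ , Ty = Sc⇒T Sy
           -- Transitivity through the origin: the inverse of the map belonging to `x` sends `x` to
           -- zero, and the map belonging to `y` sends zero to `y`.
           in t p′ y ∘ t (-ᵥ p) (-ᵥ act (-ᵥ p) x)
            , G-∘ _ _ (p′ , y , Ty , λ _ → refl) (_ , _ , T-⁻¹ Tx , λ _ → refl)
            , trans (cong (t p′ y) (+ᵥ-inverseʳ (act (-ᵥ p) x)))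
                (trans (cong (_+ᵥ y) (linear-0 (linear p′))) (+ᵥ-identityˡ y)))
      , (λ { g h x (p , w , Tw , g≗) (p′ , z , Tz , h≗) Sx gx≡hx → semiregular g h x p w Tw g≗ p′ z Tz h≗ Sx gx≡hx })
      where
      -- If `x` has degree `d`, its common image has degrees `p + d` and `p′ + d`. Uniqueness of
      -- degrees gives `p = p′`, and then the translation parts agree as well.
      semiregular : ∀ g h x p w → T p w → g ≗ t p w → ∀ p′ z → T p′ z → h ≗ t p′ z → Sc x → g x ≡ h x → g ≗ h
      semiregular g h x p w Tw g≗ p′ z Tz h≗ Sx gx≡hx y = let d , Tx = Sc⇒T Sx in
        same d Tx (trans (sym (g≗ x)) (trans gx≡hx (h≗ x)))
        where
        same : ∀ d → T d x → t p w x ≡ t p′ z x → g y ≡ h y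
        same d Tx eq with +ᵥ-cancelʳ d p p′ (T-unique (T-∙ Tw Tx) (subst (T (p′ +ᵥ d)) (sym eq) (T-∙ Tz Tx)))
        ... | refl = trans (g≗ y) (trans (cong (act p y +ᵥ_) (+ᵥ-cancelˡ (act p x) w z eq)) (sym (h≗ y)))

-- The quadratic bijection and its shears

module ShearIdentities {c ℓ} (R : CommutativeRing c ℓ) where

  open CommutativeRing R using (_≈_) renaming (_+_ to _⊕_; _*_ to _⊗_; refl to ≈-refl)
  open Algebra.Solver.Ring.NaturalCoefficients.Default (CommutativeRing.commutativeSemiring R)

  -- The second coordinate of the cocycle law of `φ`. The cross term of the square, written as a sum
  -- of two equal products, is the contribution of the shear.
  cocycle : ∀ a b a′ b′ →
    (b ⊕ b′) ⊕ (a ⊕ a′) ⊗ (a ⊕ a′) ≈ ((b′ ⊕ a′ ⊗ a′) ⊕ (a ⊗ a′ ⊕ a ⊗ a′)) ⊕ (b ⊕ a ⊗ a)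
  cocycle = solve 4 (λ a b a′ b′ →
    (b :+ b′) :+ (a :+ a′) :* (a :+ a′) := ((b′ :+ a′ :* a′) :+ (a :* a′ :+ a :* a′)) :+ (b :+ a :* a)) ≈-refl

  shear-homogeneous : ∀ c a x y x′ y′ →
    (c ⊗ y ⊕ y′) ⊕ (a ⊗ (c ⊗ x ⊕ x′) ⊕ a ⊗ (c ⊗ x ⊕ x′)) ≈ c ⊗ (y ⊕ (a ⊗ x ⊕ a ⊗ x)) ⊕ (y′ ⊕ (a ⊗ x′ ⊕ a ⊗ x′))
  shear-homogeneous = solve 6 (λ c a x y x′ y′ →
    (c :* y :+ y′) :+ (a :* (c :* x :+ x′) :+ a :* (c :* x :+ x′)) :=
    c :* (y :+ (a :* x :+ a :* x)) :+ (y′ :+ (a :* x′ :+ a :* x′))) ≈-refl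

  shear-additive : ∀ a a′ x y →
    y ⊕ ((a ⊕ a′) ⊗ x ⊕ (a ⊕ a′) ⊗ x) ≈ (y ⊕ (a′ ⊗ x ⊕ a′ ⊗ x)) ⊕ (a ⊗ x ⊕ a ⊗ x)
  shear-additive = solve 4 (λ a a′ x y →
    y :+ ((a :+ a′) :* x :+ (a :+ a′) :* x) := (y :+ (a′ :* x :+ a′ :* x)) :+ (a :* x :+ a :* x)) ≈-refl

-- This form of 2i + s lets a vector be matched plane by plane, two entries at a time.
dim : ℕ → ℕ → ℕ
dim ℕ.zero    s = s
dim (ℕ.suc i) s = ℕ.suc (ℕ.suc (dim i s))

∷∷-cong : ∀ {A : Set} {m} {a a′ b b′ : A} {v v′ : Vec A m} →
  a ≡ a′ → b ≡ b′ → v ≡ v′ → a ∷ b ∷ v ≡ a′ ∷ b′ ∷ v′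
∷∷-cong refl refl refl = refl

module Shears (q : ℕ) .{{_ : NonZero q}} where

  open ModularArithmetic q
  open Vectors q
  open ShearIdentities commutativeRing
  open ≡-Reasoning

  φ : ∀ i s → Vec (F q) (dim i s) → Vec (F q) (dim i s)
  φ ℕ.zero    s p           = p
  φ (ℕ.suc i) s (a ∷ b ∷ p) = a ∷ (b ⊕ a ⊗ a) ∷ φ i s p

  φ⁻¹ : ∀ i s → Vec (F q) (dim i s) → Vec (F q) (dim i s)
  φ⁻¹ ℕ.zero    s p           = p
  φ⁻¹ (ℕ.suc i) s (a ∷ b ∷ p) = a ∷ (b ⊕ ⊖ (a ⊗ a)) ∷ φ⁻¹ i s p

  swap : ∀ i s → Vec (F q) (dim i s) → Vec (F q) (dim i s)
  swap ℕ.zero    s p           = p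
  swap (ℕ.suc i) s (a ∷ b ∷ p) = b ∷ a ∷ swap i s p

  -- The Jacobian of `φ` at `p`: the derivative of `b + a²` in direction `(x, y)` is `y + 2ax`.
  shear : ∀ i s → Vec (F q) (dim i s) → Vec (F q) (dim i s) → Vec (F q) (dim i s)
  shear ℕ.zero    s p           v           = v
  shear (ℕ.suc i) s (a ∷ _ ∷ p) (x ∷ y ∷ v) = x ∷ (y ⊕ (a ⊗ x ⊕ a ⊗ x)) ∷ shear i s p v

  -- The coordinates in the complement of the planes, untouched by `φ`, `swap` and `shear`.
  fixed : ∀ i s → Vec (F q) (dim i s) → Vec (F q) s
  fixed ℕ.zero    s p           = p
  fixed (ℕ.suc i) s (_ ∷ _ ∷ p) = fixed i s p

  pad : ∀ i s → Vec (F q) s → Vec (F q) (dim i s)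
  pad ℕ.zero    s z = z
  pad (ℕ.suc i) s z = 𝟎 ∷ 𝟎 ∷ pad i s z

  φ-φ⁻¹ : ∀ i s p → φ i s (φ⁻¹ i s p) ≡ p
  φ-φ⁻¹ ℕ.zero    s p           = refl
  φ-φ⁻¹ (ℕ.suc i) s (a ∷ b ∷ p) = cong (a ∷_) (cong₂ _∷_
    (trans (+F-assoc b _ _) (trans (cong (b ⊕_) (+F-inverseˡ (a ⊗ a))) (+F-identityʳ b))) (φ-φ⁻¹ i s p))

  φ⁻¹-φ : ∀ i s p → φ⁻¹ i s (φ i s p) ≡ p
  φ⁻¹-φ ℕ.zero    s p           = refl
  φ⁻¹-φ (ℕ.suc i) s (a ∷ b ∷ p) = cong (a ∷_) (cong₂ _∷_
    (trans (+F-assoc b _ _) (trans (cong (b ⊕_) (+F-inverseʳ (a ⊗ a))) (+F-identityʳ b))) (φ⁻¹-φ i s p))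

  φ-injective : ∀ i s {p p′} → φ i s p ≡ φ i s p′ → p ≡ p′
  φ-injective i s {p} {p′} eq = trans (sym (φ⁻¹-φ i s p)) (trans (cong (φ⁻¹ i s) eq) (φ⁻¹-φ i s p′))

  swap-involutive : ∀ i s p → swap i s (swap i s p) ≡ p
  swap-involutive ℕ.zero    s p           = refl
  swap-involutive (ℕ.suc i) s (a ∷ b ∷ p) = cong (λ p → a ∷ b ∷ p) (swap-involutive i s p)

  swap-+ : ∀ i s p p′ → swap i s (p +ᵥ p′) ≡ swap i s p +ᵥ swap i s p′
  swap-+ ℕ.zero    s p           p′            = refl
  swap-+ (ℕ.suc i) s (_ ∷ _ ∷ p) (_ ∷ _ ∷ p′) = ∷∷-cong refl refl (swap-+ i s p p′)

  swap-0 : ∀ i s → swap i s 0ᵥ ≡ 0ᵥ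
  swap-0 ℕ.zero    s = refl
  swap-0 (ℕ.suc i) s = cong (λ p → 𝟎 ∷ 𝟎 ∷ p) (swap-0 i s)

  φ-0 : ∀ i s → φ i s 0ᵥ ≡ 0ᵥ
  φ-0 ℕ.zero    s = refl
  φ-0 (ℕ.suc i) s = cong (𝟎 ∷_) (cong₂ _∷_ (trans (cong (𝟎 ⊕_) (zeroˡ 𝟎)) (+F-identityˡ 𝟎)) (φ-0 i s))

  φ-+ : ∀ i s p p′ → φ i s (p +ᵥ p′) ≡ shear i s p (φ i s p′) +ᵥ φ i s p
  φ-+ ℕ.zero    s p           p′             = +ᵥ-comm p p′
  φ-+ (ℕ.suc i) s (a ∷ b ∷ p) (a′ ∷ b′ ∷ p′) =
    cong₂ _∷_ (+F-comm a a′) (cong₂ _∷_ (cocycle a b a′ b′) (φ-+ i s p p′))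

  shear-linear : ∀ i s p → Linear (shear i s p)
  shear-linear ℕ.zero    s p           c u           v             = refl
  shear-linear (ℕ.suc i) s (a ∷ _ ∷ p) c (x ∷ y ∷ u) (x′ ∷ y′ ∷ v) =
    cong₂ _∷_ refl (cong₂ _∷_ (shear-homogeneous c a x y x′ y′) (shear-linear i s p c u v))

  shear-+ : ∀ i s p p′ v → shear i s (p +ᵥ p′) v ≡ shear i s p (shear i s p′ v)
  shear-+ ℕ.zero    s p           p′            v           = refl
  shear-+ (ℕ.suc i) s (a ∷ _ ∷ p) (a′ ∷ _ ∷ p′) (x ∷ y ∷ v) =
    cong (x ∷_) (cong₂ _∷_ (shear-additive a a′ x y) (shear-+ i s p p′ v))

  shear-0 : ∀ i s v → shear i s 0ᵥ v ≡ v
  shear-0 ℕ.zero    s v           = refl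
  shear-0 (ℕ.suc i) s (x ∷ y ∷ v) = cong (x ∷_) (cong₂ _∷_
    (trans (cong (y ⊕_) (trans (cong₂ _⊕_ (zeroˡ x) (zeroˡ x)) (+F-identityˡ 𝟎))) (+F-identityʳ y)) (shear-0 i s v))

  shearAction : ∀ i s → LinearAction q (dim i s) (dim i s)
  shearAction i s = record
    { act = shear i s ; linear = shear-linear i s ; act-0 = shear-0 i s ; act-+ = shear-+ i s }

  -- The extra leading coordinate is the 1 of the vectors `(1, c)`. Since it is kept, these vectors
  -- are permuted with scalar 1.
  swappedAction : ∀ i s → LinearAction q (dim i s) (ℕ.suc (dim i s))
  swappedAction i s = record
    { act = act ; linear = linear ; act-0 = act-0 ; act-+ = act-+ }
    where
    act : Vec (F q) (dim i s) → Vec (F q) (ℕ.suc (dim i s)) → Vec (F q) (ℕ.suc (dim i s))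
    act p (a ∷ v) = a ∷ shear i s (swap i s p) v
    linear : ∀ p → Linear (act p)
    linear p c (a ∷ u) (b ∷ v) = cong₂ _∷_ refl (shear-linear i s (swap i s p) c u v)
    act-0 : ∀ v → act 0ᵥ v ≡ v
    act-0 (a ∷ v) = cong (a ∷_) (trans (cong (λ p → shear i s p v) (swap-0 i s)) (shear-0 i s v))
    act-+ : ∀ p p′ v → act (p +ᵥ p′) v ≡ act p (act p′ v)
    act-+ p p′ (a ∷ v) = cong (a ∷_) (trans (cong (λ p → shear i s p v) (swap-+ i s p p′)) (shear-+ i s _ _ v))

  -- A conjugate of the involution `swap`, hence its own inverse.
  τ : ∀ i s → Vec (F q) (dim i s) ↔ Vec (F q) (dim i s)
  τ i s = mk↔ₛ′ t t
    (λ a → inv a) (λ a → inv a)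
    where
    t : Vec (F q) (dim i s) → Vec (F q) (dim i s)
    t = φ i s ∘ swap i s ∘ φ⁻¹ i s
    inv : ∀ a → t (t a) ≡ a
    inv a = trans (cong (φ i s ∘ swap i s) (φ⁻¹-φ i s _))
      (trans (cong (φ i s) (swap-involutive i s _)) (φ-φ⁻¹ i s a))

  fixed-linear : ∀ i s → Linear (fixed i s)
  fixed-linear ℕ.zero    s c u           v           = refl
  fixed-linear (ℕ.suc i) s c (_ ∷ _ ∷ u) (_ ∷ _ ∷ v) = fixed-linear i s c u v

  fixed-φ : ∀ i s p → fixed i s (φ i s p) ≡ fixed i s p
  fixed-φ ℕ.zero    s p           = refl
  fixed-φ (ℕ.suc i) s (_ ∷ _ ∷ p) = fixed-φ i s p

  fixed-swap : ∀ i s p → fixed i s (swap i s p) ≡ fixed i s p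
  fixed-swap ℕ.zero    s p           = refl
  fixed-swap (ℕ.suc i) s (_ ∷ _ ∷ p) = fixed-swap i s p

  fixed-pad : ∀ i s z → fixed i s (pad i s z) ≡ z
  fixed-pad ℕ.zero    s z = refl
  fixed-pad (ℕ.suc i) s z = fixed-pad i s z

  -- The span of the syndromes of codewords

  module _ (h : F q) (h+h≡1 : h ⊕ h ≡ 𝟏) where

    module _ {Y : F q → F q → F q → F q → Set}
      (Y-closed : ∀ c {x y z w x′ y′ z′ w′} → Y x y z w → Y x′ y′ z′ w′ →
        Y (c ⊗ x ⊕ x′) (c ⊗ y ⊕ y′) (c ⊗ z ⊕ z′) (c ⊗ w ⊕ w′))
      (Y-∋ : ∀ a b → Y a (b ⊕ a ⊗ a) (⊖ b) (⊖ (a ⊕ b ⊗ b))) where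

      private
        cast : ∀ {x y z w x′ y′ z′ w′} → x ≡ x′ → y ≡ y′ → z ≡ z′ → w ≡ w′ → Y x y z w → Y x′ y′ z′ w′
        cast refl refl refl refl Yv = Yv

        0+0 : 𝟎 ⊕ 𝟎 ≡ 𝟎
        0+0 = +F-identityˡ 𝟎

        0+0·0 : ∀ a → a ⊕ 𝟎 ⊗ 𝟎 ≡ a
        0+0·0 a = trans (cong (a ⊕_) (zeroˡ 𝟎)) (+F-identityʳ a)

        left : ∀ a → Y a (a ⊗ a) 𝟎 (⊖ a)
        left a = cast refl (+F-identityˡ (a ⊗ a)) ⊖0≡0 (cong ⊖_ (0+0·0 a)) (Y-∋ a 𝟎)

        right : ∀ b → Y 𝟎 b (⊖ b) (⊖ (b ⊗ b))
        right b = cast refl (0+0·0 b) refl (cong ⊖_ (+F-identityˡ (b ⊗ b))) (Y-∋ 𝟎 b)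

        zero∈ : Y 𝟎 𝟎 𝟎 𝟎
        zero∈ = cast refl (zeroˡ 𝟎) refl ⊖0≡0 (left 𝟎)

        add : ∀ {x y z w x′ y′ z′ w′} → Y x y z w → Y x′ y′ z′ w′ → Y (x ⊕ x′) (y ⊕ y′) (z ⊕ z′) (w ⊕ w′)
        add Yu Yv = cast (one _ _) (one _ _) (one _ _) (one _ _) (Y-closed 𝟏 Yu Yv)
          where
          one : ∀ x x′ → 𝟏 ⊗ x ⊕ x′ ≡ x ⊕ x′
          one x x′ = cong (_⊕ x′) (*F-identityˡ x)

        scale : ∀ c {x y z w} → Y x y z w → Y (c ⊗ x) (c ⊗ y) (c ⊗ z) (c ⊗ w)
        scale c Yu = cast (+F-identityʳ _) (+F-identityʳ _) (+F-identityʳ _) (+F-identityʳ _) (Y-closed c Yu zero∈)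

        [-1]² : ⊖ 𝟏 ⊗ ⊖ 𝟏 ≡ 𝟏
        [-1]² = trans (-1*x≈-x (⊖ 𝟏)) (⊖-involutive 𝟏)

        halve : ∀ a → (h ⊗ a) ⊗ (𝟏 ⊕ 𝟏) ≡ a
        halve a = begin
          (h ⊗ a) ⊗ (𝟏 ⊕ 𝟏)   ≡⟨ *F-comm (h ⊗ a) (𝟏 ⊕ 𝟏) ⟩
          (𝟏 ⊕ 𝟏) ⊗ (h ⊗ a)   ≡⟨ double (h ⊗ a) ⟨
          h ⊗ a ⊕ h ⊗ a       ≡⟨ *F-distribʳ-+F a h h ⟨
          (h ⊕ h) ⊗ a         ≡⟨ cong (_⊗ a) h+h≡1 ⟩
          𝟏 ⊗ a               ≡⟨ *F-identityˡ a ⟩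
          a                   ∎

        -- In `left 𝟏` plus `left (⊖ 𝟏)` the odd entries cancel and the squares double, leaving
        -- `(0, 2, 0, 0)`; the factor `h ⊗ y` turns 2 into `y`.
        axis₂ : ∀ y → Y 𝟎 y 𝟎 𝟎
        axis₂ y = cast (zeroʳ c) (halve y) (zeroʳ c) (zeroʳ c) (scale c
          (cast (+F-inverseʳ 𝟏) (cong₂ _⊕_ (*F-identityˡ 𝟏) [-1]²) 0+0 (+F-inverseʳ (⊖ 𝟏)) (add (left 𝟏) (left (⊖ 𝟏)))))
          where c = h ⊗ y

        -- The same with `right`, whose two values add to `(0, 0, 0, −2)`; hence the sign in the
        -- factor.
        axis₄ : ∀ w → Y 𝟎 𝟎 𝟎 w
        axis₄ w = cast (zeroʳ c) (zeroʳ c) (zeroʳ c) coefficient (scale c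
          (cast 0+0 (+F-inverseʳ 𝟏) (+F-inverseʳ (⊖ 𝟏))
            (cong₂ (λ a b → ⊖ a ⊕ ⊖ b) (*F-identityˡ 𝟏) [-1]²) (add (right 𝟏) (right (⊖ 𝟏)))))
          where
          c = h ⊗ ⊖ w
          coefficient : c ⊗ (⊖ 𝟏 ⊕ ⊖ 𝟏) ≡ w
          coefficient = begin
            c ⊗ (⊖ 𝟏 ⊕ ⊖ 𝟏)     ≡⟨ cong (c ⊗_) (⊖-+-comm 𝟏 𝟏) ⟩
            c ⊗ ⊖ (𝟏 ⊕ 𝟏)       ≡⟨ -‿distribʳ-* c (𝟏 ⊕ 𝟏) ⟨
            ⊖ (c ⊗ (𝟏 ⊕ 𝟏))     ≡⟨ cong ⊖_ (halve (⊖ w)) ⟩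
            ⊖ ⊖ w               ≡⟨ ⊖-involutive w ⟩
            w                   ∎

        -- With the axes that carry squares at hand, the square and the last entry of `left x` can
        -- be removed. For `axis₃` the same is done to `right`.
        axis₁ : ∀ x → Y x 𝟎 𝟎 𝟎
        axis₁ x = cast
          (trans (cong (x ⊕_) 0+0) (+F-identityʳ x))
          (trans (cong (x ⊗ x ⊕_) (+F-identityʳ _)) (+F-inverseʳ (x ⊗ x)))
          (trans (cong (𝟎 ⊕_) 0+0) 0+0)
          (trans (cong (⊖ x ⊕_) (+F-identityˡ x)) (+F-inverseˡ x))
          (add (left x) (add (axis₂ (⊖ (x ⊗ x))) (axis₄ x)))

        axis₃ : ∀ z → Y 𝟎 𝟎 z 𝟎
        axis₃ z = cast
          (trans (cong (𝟎 ⊕_) 0+0) 0+0)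
          (trans (cong (⊖ z ⊕_) (+F-identityʳ z)) (+F-inverseˡ z))
          (trans (cong (⊖ ⊖ z ⊕_) 0+0) (trans (+F-identityʳ _) (⊖-involutive z)))
          (trans (cong (⊖ (⊖ z ⊗ ⊖ z) ⊕_) (+F-identityˡ _)) (+F-inverseˡ (⊖ z ⊗ ⊖ z)))
          (add (right (⊖ z)) (add (axis₂ z) (axis₄ (⊖ z ⊗ ⊖ z))))

      pair-generated : ∀ x y z w → Y x y z w
      pair-generated x y z w = cast
        (trans (cong (λ a → x ⊕ (𝟎 ⊕ a)) 0+0) (trans (cong (x ⊕_) 0+0) (+F-identityʳ x)))
        (trans (+F-identityˡ _) (trans (cong (y ⊕_) 0+0) (+F-identityʳ y)))
        (trans (+F-identityˡ _) (trans (+F-identityˡ _) (+F-identityʳ z)))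
        (trans (+F-identityˡ _) (trans (+F-identityˡ _) (+F-identityˡ w)))
        (add (axis₁ x) (add (axis₂ y) (add (axis₃ z) (axis₄ w))))

    -- `X` plays the role of a subspace of pairs. Parameters supported on one plane stay there, as
    -- `φ` and `swap` fix zero, and generate all four of its coordinates. On the complement the
    -- hypothesis forces `b = −a`, which is already a generator.
    graph-generated : ∀ i s {X : Vec (F q) (dim i s) → Vec (F q) (dim i s) → Set} →
      (∀ c {u v u′ v′} → X u v → X u′ v′ → X (c ·ᵥ u +ᵥ u′) (c ·ᵥ v +ᵥ v′)) →
      (∀ p → X (φ i s p) (-ᵥ φ i s (swap i s p))) →
      ∀ a b → fixed i s a +ᵥ fixed i s b ≡ 0ᵥ → X a b
    graph-generated ℕ.zero s {X} closed ∋ a b eq = subst (X a) (sym (-ᵥ-uniqueʳ a b eq)) (∋ a)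
    graph-generated (ℕ.suc i) s {X} closed ∋ (x ∷ y ∷ a) (z ∷ w ∷ b) eq =
      subst₂ X (reassemble x y a) (reassemble z w b)
        (closed 𝟏
          (pair-generated {Y = λ x y z w → X (x ∷ y ∷ 0ᵥ) (z ∷ w ∷ 0ᵥ)}
            (λ c {x} {y} {z} {w} Yu Yv → subst₂ X
              (∷∷-cong refl refl (c0+0 c)) (∷∷-cong refl refl (c0+0 c)) (closed c Yu Yv))
            (λ a b → subst₂ X
              (∷∷-cong refl refl (φ-0 i s))
              (∷∷-cong refl refl (trans (cong (-ᵥ_ ∘ φ i s) (swap-0 i s)) (trans (cong -ᵥ_ (φ-0 i s)) -ᵥ0≡0)))
              (∋ (a ∷ b ∷ 0ᵥ)))
            x y z w)
          (graph-generated i s {X = λ a b → X (𝟎 ∷ 𝟎 ∷ a) (𝟎 ∷ 𝟎 ∷ b)}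
            (λ c Xu Xv → subst₂ X (∷∷-cong (c0 c) (c0 c) refl) (∷∷-cong (c0 c) (c0 c) refl) (closed c Xu Xv))
            (λ p → subst₂ X
              (∷∷-cong refl 0+0·0 refl)
              (∷∷-cong ⊖0≡0 (trans (cong ⊖_ 0+0·0) ⊖0≡0) refl)
              (∋ (𝟎 ∷ 𝟎 ∷ p)))
            a b eq))
      where
      c0 : ∀ c → c ⊗ 𝟎 ⊕ 𝟎 ≡ 𝟎
      c0 c = trans (+F-identityʳ _) (zeroʳ c)
      0+0·0 : 𝟎 ⊕ 𝟎 ⊗ 𝟎 ≡ 𝟎
      0+0·0 = trans (+F-identityˡ _) (zeroˡ 𝟎)
      c0+0 : ∀ {m} c → c ·ᵥ 0ᵥ {m} +ᵥ 0ᵥ ≡ 0ᵥ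
      c0+0 c = trans (+ᵥ-identityʳ _) (·ᵥ-zeroʳ c)
      reassemble : ∀ {m} x y (v : Vec (F q) m) → 𝟏 ·ᵥ (x ∷ y ∷ 0ᵥ) +ᵥ (𝟎 ∷ 𝟎 ∷ v) ≡ x ∷ y ∷ v
      reassemble x y v = cong₂ _∷_ (1x x) (cong₂ _∷_ (1x y) (trans (cong (_+ᵥ v) (·ᵥ-zeroʳ 𝟏)) (+ᵥ-identityˡ v)))
        where
        1x : ∀ x → 𝟏 ⊗ x ⊕ 𝟎 ≡ x
        1x x = trans (+F-identityʳ _) (*F-identityˡ x)

-- Counting one-dimensional subspaces

geom : ℕ → ℕ → ℕ
geom q ℕ.zero    = 0
geom q (ℕ.suc m) = geom q m + q ^ m

geom-* : ∀ k m → ℕ.suc (geom (ℕ.suc k) m * k) ≡ ℕ.suc k ^ m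
geom-* k ℕ.zero    = refl
geom-* k (ℕ.suc m) = begin
  ℕ.suc ((geom q m + q ^ m) * k)        ≡⟨ cong ℕ.suc (ℕₚ.*-distribʳ-+ k (geom q m) (q ^ m)) ⟩
  ℕ.suc (geom q m * k) + q ^ m * k      ≡⟨ cong₂ _+_ (geom-* k m) (ℕₚ.*-comm (q ^ m) k) ⟩
  q ^ m + k * q ^ m                     ∎
  where
  open ≡-Reasoning
  q = ℕ.suc k

-- Trades truncated subtraction and floor division for the sum of the powers of q below the m-th;
-- the division is exact by `geom-*`.
geomLen≡geom : ∀ {q} m → 2 ≤ q → geomLen q m ≡ geom q m
geomLen≡geom {ℕ.suc (ℕ.suc k)} m (s≤s (s≤s _)) =
  trans (cong (λ a → (a ∸ 1) / ℕ.suc k) (sym (geom-* (ℕ.suc k) m))) (m*n/n≡m (geom (ℕ.suc (ℕ.suc k)) m) (ℕ.suc k))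

geomLen-suc : ∀ {q} m → 2 ≤ q → geomLen q m + q ^ m ≡ geomLen q (m + 1)
geomLen-suc {q} m 2≤q = begin
  geomLen q m + q ^ m   ≡⟨ cong (_+ q ^ m) (geomLen≡geom m 2≤q) ⟩
  geom q (ℕ.suc m)      ≡⟨ geomLen≡geom (ℕ.suc m) 2≤q ⟨
  geomLen q (ℕ.suc m)   ≡⟨ cong (geomLen q) (ℕₚ.+-comm 1 m) ⟩
  geomLen q (m + 1)     ∎
  where open ≡-Reasoning

geomLen-count : ∀ {q} m → 2 ≤ q → ℕ.suc (geomLen q m * ℕ.pred q) ≡ q ^ m
geomLen-count {ℕ.suc k} m 2≤q = trans (cong (λ a → ℕ.suc (a * k)) (geomLen≡geom m 2≤q)) (geom-* k m)

-- Ensures that the subtraction in the rank formula does not truncate.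
m<q^m : ∀ {q} m → 2 ≤ q → m < q ^ m
m<q^m ℕ.zero    2≤q = s≤s z≤n
m<q^m {q} (ℕ.suc m) 2≤q = begin
  ℕ.suc (ℕ.suc m)   ≤⟨ ℕₚ.+-mono-≤ (s≤s (z≤n {m})) (m<q^m m 2≤q) ⟩
  ℕ.suc m + q ^ m   ≤⟨ ℕₚ.+-monoˡ-≤ (q ^ m) (m<q^m m 2≤q) ⟩
  q ^ m + q ^ m     ≡⟨ cong (q ^ m +_) (ℕₚ.+-identityʳ (q ^ m)) ⟨
  2 * q ^ m         ≤⟨ ℕₚ.*-monoˡ-≤ (q ^ m) 2≤q ⟩
  q * q ^ m         ∎
  where open ℕₚ.≤-Reasoning

injective⇒onto : ∀ {k l} {A : Set} → k ≡ l → (e : Fin l ↔ A) (g : Fin k → A) → Injective _≡_ _≡_ g → ∀ a → ∃[ x ] g x ≡ a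
injective⇒onto refl e g inj a =
  let x , eq = injective⇒surjective (Inverse.from e ∘ g) (inj ∘ from-injective) (Inverse.from e a) in x , from-injective eq
  where
  from-injective : ∀ {a b} → Inverse.from e a ≡ Inverse.from e b → a ≡ b
  from-injective {a} {b} eq = trans (sym (Inverse.strictlyInverseˡ e a))
    (trans (cong (Inverse.to e) eq) (Inverse.strictlyInverseˡ e b))

-- The q − 1 nonzero multiples of the n columns, together with 0, are 1 + n(q − 1) = q^r
-- distinct vectors, hence all of them.
columns-cover : ∀ q .{{_ : NonZero q}} → Prime q → ∀ {r n} (H : Vec (Vec (F q) r) n) → IsHammingCheck q r n H →
  Fin (q ^ r) ↔ Vec (F q) r → ℕ.suc (n * ℕ.pred q) ≡ q ^ r →
  ∀ v → v ≢ 0V q → ∃[ j ] ∃[ ν ] v ≡ _·V_ q ν (lookup H j)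
columns-cover (ℕ.suc k) p {r} {n} H (h≢0 , distinct) e count v v≢0 with injective⇒onto count e multiple multiple-injective v
  where
  open PrimeField (ℕ.suc k) p
  open Vectors (ℕ.suc k)
  open Scaling (ℕ.suc k) p

  unit-multiple : Fin n × Fin k → Vec (F (ℕ.suc k)) r
  -- `punchIn 𝟎` enumerates the `k` nonzero scalars, the field having `ℕ.suc k` elements.
  unit-multiple (j , l) = punchIn 𝟎 l ·ᵥ lookup H j

  multiple : Fin (ℕ.suc (n * k)) → Vec (F (ℕ.suc k)) r
  multiple Fin.zero    = 0ᵥ
  multiple (Fin.suc t) = unit-multiple (remQuot k t)

  unit-multiple≢0 : ∀ jl → unit-multiple jl ≢ 0ᵥ
  unit-multiple≢0 (j , l) eq = punchInᵢ≢i 𝟎 l (·ᵥ-cancelʳ (punchIn 𝟎 l) 𝟎 _ (h≢0 j) (trans eq (sym (·ᵥ-zeroˡ _))))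

  unit-multiple-injective : ∀ jl jl′ → unit-multiple jl ≡ unit-multiple jl′ → jl ≡ jl′
  unit-multiple-injective (j , l) (j′ , l′) eq
    with c , hj≡c·hj′ ← ·ᵥ-solve (punchIn 𝟎 l) (punchIn 𝟎 l′) (punchInᵢ≢i 𝟎 l) eq
    with distinct j j′ c hj≡c·hj′
  ... | refl = cong (j ,_) (punchIn-injective 𝟎 l l′ (·ᵥ-cancelʳ (punchIn 𝟎 l) (punchIn 𝟎 l′) _ (h≢0 j) eq))

  multiple-injective : Injective _≡_ _≡_ multiple
  multiple-injective {Fin.zero}  {Fin.zero}   eq = refl
  multiple-injective {Fin.zero}  {Fin.suc t}  eq = ⊥-elim (unit-multiple≢0 (remQuot k t) (sym eq))
  multiple-injective {Fin.suc t} {Fin.zero}   eq = ⊥-elim (unit-multiple≢0 (remQuot k t) eq)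
  multiple-injective {Fin.suc t} {Fin.suc t′} eq = cong Fin.suc (trans (sym (combine-remQuot {n} k t))
    (trans (cong (λ (j , l) → combine j l) (unit-multiple-injective (remQuot k t) (remQuot k t′) eq)) (combine-remQuot {n} k t′)))
... | Fin.zero  , eq = ⊥-elim (v≢0 (sym eq))
... | Fin.suc t , eq = proj₁ (remQuot {n} k t) , punchIn (0F (ℕ.suc k)) (proj₂ (remQuot {n} k t)) , sym eq

-- Codes whose two syndromes follow a pair of cocycles

take-++ : ∀ {A : Set} {m n} (x : Vec A m) (y : Vec A n) → take m (x ++ y) ≡ x
take-++ {m = m} x y = proj₁ (++-injective _ x (take++drop≡id m (x ++ y)))

drop-++ : ∀ {A : Set} {m n} (x : Vec A m) (y : Vec A n) → drop m (x ++ y) ≡ y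
drop-++ {m = m} x y = proj₂ (++-injective (take m (x ++ y)) x (take++drop≡id m (x ++ y)))

-- A 1-cocycle of the additive group with values in the representation; equivalently, the maps
-- `v ↦ act p v +ᵥ ψ p` compose as the parameters add.
record Cocycle {q : ℕ} .{{_ : NonZero q}} {r m : ℕ} (L : LinearAction q r m) : Set where
  open Vectors q
  open LinearAction L
  field
    ψ   : Vec (F q) r → Vec (F q) m
    ψ-0 : ψ 0ᵥ ≡ 0ᵥ
    ψ-+ : ∀ p p′ → ψ (p +ᵥ p′) ≡ act p (ψ p′) +ᵥ ψ p

  ψ-neg : ∀ p → -ᵥ act (-ᵥ p) (ψ p) ≡ ψ (-ᵥ p)
  ψ-neg p = sym (-ᵥ-uniqueʳ _ _
    (trans (sym (ψ-+ (-ᵥ p) p)) (trans (cong ψ (+ᵥ-inverseˡ p)) ψ-0)))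

module DirectSum (q : ℕ) .{{_ : NonZero q}} {r m n : ℕ} (L₁ : LinearAction q r m) (L₂ : LinearAction q r n) where

  open Vectors q
  open Isometries q
  open ≡-Reasoning
  private
    module L₁ = LinearAction L₁
    module L₂ = LinearAction L₂

  act : Vec (F q) r → Vec (F q) (m + n) → Vec (F q) (m + n)
  act p w = L₁.act p (take m w) ++ L₂.act p (drop m w)

  take-act : ∀ p w → take m (act p w) ≡ L₁.act p (take m w)
  take-act p w = take-++ _ _

  drop-act : ∀ p w → drop m (act p w) ≡ L₂.act p (drop m w)
  drop-act p w = drop-++ (L₁.act p (take m w)) _

  directSum : LinearAction q r (m + n)
  directSum = record
    { act = act
    ; linear = λ p c u v → begin
        act p (c ·ᵥ u +ᵥ v)
          ≡⟨ cong₂ _++_ (linear-∘ (L₁.linear p) (take-linear m) c u v) (linear-∘ (L₂.linear p) (drop-linear m) c u v) ⟩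
        (c ·ᵥ L₁.act p (take m u) +ᵥ L₁.act p (take m v)) ++ (c ·ᵥ L₂.act p (drop m u) +ᵥ L₂.act p (drop m v))
          ≡⟨ zipWith-++ _ (c ·ᵥ L₁.act p (take m u)) _ _ _ ⟨
        (c ·ᵥ L₁.act p (take m u) ++ c ·ᵥ L₂.act p (drop m u)) +ᵥ act p v
          ≡⟨ cong (_+ᵥ act p v) (map-++ _ (L₁.act p (take m u)) _) ⟨
        c ·ᵥ act p u +ᵥ act p v ∎
    ; act-0 = λ w → trans (cong₂ _++_ (L₁.act-0 _) (L₂.act-0 _)) (take++drop≡id m w)
    ; act-+ = λ p p′ w → trans (cong₂ _++_ (L₁.act-+ p p′ _) (L₂.act-+ p p′ _))
        (sym (cong₂ (λ x y → L₁.act p x ++ L₂.act p y) (take-act p′ w) (drop-act p′ w)))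
    }

  directSum-isometry : (∀ p → IsIsometry q (L₁.act p)) → (∀ p → IsIsometry q (L₂.act p)) → ∀ p → IsIsometry q (act p)
  directSum-isometry iso₁ iso₂ p u v = begin
    dH q (act p u) (act p v)
      ≡⟨ dH-++ (L₁.act p (take m u)) _ _ _ ⟩
    dH q (L₁.act p (take m u)) (L₁.act p (take m v)) + dH q (L₂.act p (drop m u)) (L₂.act p (drop m v))
      ≡⟨ cong₂ _+_ (iso₁ p _ _) (iso₂ p _ _) ⟩
    dH q (take m u) (take m v) + dH q (drop m u) (drop m v)
      ≡⟨ dH-++ (take m u) _ _ _ ⟨
    dH q (take m u ++ drop m u) (take m v ++ drop m v)
      ≡⟨ cong₂ (dH q) (take++drop≡id m u) (take++drop≡id m v) ⟩
    dH q u v ∎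

module CocycleCode (q : ℕ) .{{_ : NonZero q}} (prime : Prime q) {r m₁ m₂ n₁ n₂ : ℕ}
  (L₁ : LinearAction q r m₁) (L₂ : LinearAction q r m₂) (c₁ : Cocycle L₁) (c₂ : Cocycle L₂)
  (h₁ : Vec (Vec (F q) m₁) n₁) (h₂ : Vec (Vec (F q) m₂) n₂) where

  open Vectors q
  open ≡-Reasoning
  private
    module L₁ = LinearAction L₁
    module L₂ = LinearAction L₂
    module C₁ = Cocycle c₁
    module C₂ = Cocycle c₂

  syndrome₁ : Vec (F q) (n₁ + n₂) → Vec (F q) m₁
  syndrome₁ w = lincomb q (take n₁ w) h₁

  syndrome₂ : Vec (F q) (n₁ + n₂) → Vec (F q) m₂
  syndrome₂ w = lincomb q (drop n₁ w) h₂

  syndrome₁-linear : Linear syndrome₁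
  syndrome₁-linear = linear-∘ (lincomb-linear h₁) (take-linear n₁)

  syndrome₂-linear : Linear syndrome₂
  syndrome₂-linear = linear-∘ (lincomb-linear h₂) (drop-linear n₁)

  -- One parameter governs both halves of the word; this is the coupling of cosets through the
  -- permutation.
  HasDegree : Vec (F q) r → Vec (F q) (n₁ + n₂) → Set
  HasDegree p w = syndrome₁ w ≡ C₁.ψ p × syndrome₂ w ≡ C₂.ψ p

  hasDegree-0 : HasDegree 0ᵥ 0ᵥ
  hasDegree-0 = trans (linear-0 syndrome₁-linear) (sym C₁.ψ-0) , trans (linear-0 syndrome₂-linear) (sym C₂.ψ-0)

  module _ (check₁ : IsHammingCheck q m₁ n₁ h₁) (check₂ : IsHammingCheck q m₂ n₂ h₂)
    (permutesLines₁ : ∀ p k → ∃[ j ] ∃[ ν ] L₁.act p (lookup h₁ k) ≡ ν ·ᵥ lookup h₁ j)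
    (permutesLines₂ : ∀ p k → ∃[ j ] ∃[ ν ] L₂.act p (lookup h₂ k) ≡ ν ·ᵥ lookup h₂ j)
    (ψ₁-injective : ∀ {p p′} → C₁.ψ p ≡ C₁.ψ p′ → p ≡ p′) where

    private
      module M₁ = MonomialLift q prime L₁ h₁
      module M₂ = MonomialLift q prime L₂ h₂
      open DirectSum q (M₁.liftAction check₁ permutesLines₁) (M₂.liftAction check₂ permutesLines₂)

      syndrome₁-act : ∀ p w → syndrome₁ (act p w) ≡ L₁.act p (syndrome₁ w)
      syndrome₁-act p w = trans (cong (λ x → lincomb q x h₁) (take-act p w))
        (M₁.lincomb-lift check₁ permutesLines₁ p (take n₁ w))

      syndrome₂-act : ∀ p w → syndrome₂ (act p w) ≡ L₂.act p (syndrome₂ w)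
      syndrome₂-act p w = trans (cong (λ x → lincomb q x h₂) (drop-act p w))
        (M₂.lincomb-lift check₂ permutesLines₂ p (drop n₁ w))

      -- The lift turns the syndrome of `z` into `act p (ψ p′)`, so in each half the syndrome of the
      -- sum is the right-hand side of the cocycle law.
      hasDegree-∙ : ∀ {p p′ w z} → HasDegree p w → HasDegree p′ z → HasDegree (p +ᵥ p′) (act p z +ᵥ w)
      hasDegree-∙ {p} {p′} {w} {z} (w₁ , w₂) (z₁ , z₂) =
          trans (linear-+ syndrome₁-linear (act p z) w) (trans
            (cong₂ _+ᵥ_ (trans (syndrome₁-act p z) (cong (L₁.act p) z₁)) w₁) (sym (C₁.ψ-+ p p′)))
        , trans (linear-+ syndrome₂-linear (act p z) w) (trans
            (cong₂ _+ᵥ_ (trans (syndrome₂-act p z) (cong (L₂.act p) z₂)) w₂) (sym (C₂.ψ-+ p p′)))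

      hasDegree-⁻¹ : ∀ {p w} → HasDegree p w → HasDegree (-ᵥ p) (-ᵥ act (-ᵥ p) w)
      hasDegree-⁻¹ {p} {w} (w₁ , w₂) =
          trans (linear-neg syndrome₁-linear (act (-ᵥ p) w)) (trans
            (cong -ᵥ_ (trans (syndrome₁-act (-ᵥ p) w) (cong (L₁.act (-ᵥ p)) w₁))) (C₁.ψ-neg p))
        , trans (linear-neg syndrome₂-linear (act (-ᵥ p) w)) (trans
            (cong -ᵥ_ (trans (syndrome₂-act (-ᵥ p) w) (cong (L₂.act (-ᵥ p)) w₂))) (C₂.ψ-neg p))

    cocycleCode-propelinear : {Sc : Vec (F q) (n₁ + n₂) → Set} →
      (∀ {w} → Sc w → ∃[ p ] HasDegree p w) → (∀ {p w} → HasDegree p w → Sc w) → IsPropelinear q Sc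
    cocycleCode-propelinear Sc⇒T T⇒Sc = RegularAction.isPropelinear q directSum {T = HasDegree}
      (directSum-isometry (M₁.lift-isometry check₁ permutesLines₁) (M₂.lift-isometry check₂ permutesLines₂))
      -- The degree is read off the first syndrome.
      Sc⇒T T⇒Sc (λ (eq , _) (eq′ , _) → ψ₁-injective (trans (sym eq) eq′))
      hasDegree-0 hasDegree-∙ hasDegree-⁻¹

-- The code S_τ: group and span

module _ (q : ℕ) .{{_ : NonZero q}} (prime : Prime q) (3≤q : 3 ≤ q) (i s : ℕ) {n : ℕ}
  (H : Vec (Vec (F q) (dim i s)) n) (check : IsHammingCheck q (dim i s) n H)
  (e : Fin (q ^ dim i s) ↔ Vec (F q) (dim i s)) (count : ℕ.suc (n * ℕ.pred q) ≡ q ^ dim i s) where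

  open PrimeField q prime
  open Vectors q
  open Kernels q prime using (kernel-basis)
  open Shears q

  private
    r = dim i s
    Q = q ^ r

    from : Vec (F q) r → Fin Q
    from = Inverse.from e

    -- Prefixing 1 to every position makes (Σ y_c, Σ y_c c) a single syndrome, and makes the columns
    -- pairwise non-proportional.
    Ĥ : Vec (Vec (F q) (ℕ.suc r)) Q
    Ĥ = tabulate (λ j → 𝟏 ∷ pos q e j)

    -- For `t = φ (σ p)` the words of `D + e_0 − e_t` have syndrome `(1, 0) − (1, t) = (0, −t)`,
    -- whence the zero and the sign.
    ψ₂ : Vec (F q) r → Vec (F q) (ℕ.suc r)
    ψ₂ p = 𝟎 ∷ -ᵥ φ i s (swap i s p)

    φ-cocycle : Cocycle (shearAction i s)
    φ-cocycle = record { ψ = φ i s ; ψ-0 = φ-0 i s ; ψ-+ = φ-+ i s }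

    ψ₂-cocycle : Cocycle (swappedAction i s)
    ψ₂-cocycle = record
      { ψ = ψ₂
      ; ψ-0 = cong (𝟎 ∷_) (trans (cong (-ᵥ_ ∘ φ i s) (swap-0 i s)) (trans (cong -ᵥ_ (φ-0 i s)) -ᵥ0≡0))
      ; ψ-+ = λ p p′ → cong₂ _∷_ (sym (+F-identityˡ 𝟎)) (begin
          -ᵥ φ i s (swap i s (p +ᵥ p′))
            ≡⟨ cong (-ᵥ_ ∘ φ i s) (swap-+ i s p p′) ⟩
          -ᵥ φ i s (swap i s p +ᵥ swap i s p′)
            ≡⟨ cong -ᵥ_ (φ-+ i s (swap i s p) (swap i s p′)) ⟩
          -ᵥ (shear i s (swap i s p) (φ i s (swap i s p′)) +ᵥ φ i s (swap i s p))
            ≡⟨ -ᵥ-+ᵥ-comm _ _ ⟨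
          -ᵥ shear i s (swap i s p) (φ i s (swap i s p′)) +ᵥ -ᵥ φ i s (swap i s p)
            ≡⟨ cong (_+ᵥ _) (linear-neg (shear-linear i s (swap i s p)) _) ⟨
          shear i s (swap i s p) (-ᵥ φ i s (swap i s p′)) +ᵥ -ᵥ φ i s (swap i s p) ∎)
      }
      where open ≡-Reasoning

    lookup-Ĥ : ∀ j → lookup Ĥ j ≡ 𝟏 ∷ pos q e j
    lookup-Ĥ = lookup∘tabulate _

    lookup-Ĥ-from : ∀ c → lookup Ĥ (from c) ≡ 𝟏 ∷ c
    lookup-Ĥ-from c = trans (lookup-Ĥ (from c)) (cong (𝟏 ∷_) (Inverse.strictlyInverseˡ e c))

    Ĥ-check : IsHammingCheck q (ℕ.suc r) Q Ĥ
    Ĥ-check =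
        (λ j eq → 1≢0 (proj₁ (∷-injective (trans (sym (lookup-Ĥ j)) eq))))
      , distinct
      where
      distinct : ∀ j k c → lookup Ĥ j ≡ c ·ᵥ lookup Ĥ k → j ≡ k
      distinct j k c eq =
        let 1≡c1 , j≡ck = ∷-injective (trans (sym (lookup-Ĥ j)) (trans eq (cong (c ·ᵥ_) (lookup-Ĥ k))))
            c≡1 = trans (sym (*F-identityʳ c)) (sym 1≡c1)
            j≡k = trans j≡ck (trans (cong (_·ᵥ pos q e k) c≡1) (·ᵥ-identity _))
        in trans (sym (Inverse.strictlyInverseʳ e j)) (trans (cong from j≡k) (Inverse.strictlyInverseʳ e k))

    open CocycleCode q prime (shearAction i s) (swappedAction i s) φ-cocycle ψ₂-cocycle H Ĥ

    cover : ∀ v → v ≢ 0ᵥ → ∃[ j ] ∃[ ν ] v ≡ ν ·ᵥ lookup H j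
    cover = columns-cover q prime H check e count

    -- Every line has a representative among the columns, so it is enough that an invertible map
    -- keeps columns nonzero.
    shear-permutesLines : ∀ p k → ∃[ j ] ∃[ ν ] shear i s p (lookup H k) ≡ ν ·ᵥ lookup H j
    shear-permutesLines p k = cover _ (λ eq → proj₁ check k
      (trans (sym (LinearAction.act-inverseˡ (shearAction i s) p _))
        (trans (cong (shear i s (-ᵥ p)) eq) (linear-0 (shear-linear i s (-ᵥ p))))))

    swapped-permutesLines : ∀ p k → ∃[ j ] ∃[ ν ] LinearAction.act (swappedAction i s) p (lookup Ĥ k) ≡ ν ·ᵥ lookup Ĥ j
    swapped-permutesLines p k = from c , 𝟏 , trans (cong (LinearAction.act (swappedAction i s) p) (lookup-Ĥ k))
      (trans (sym (lookup-Ĥ-from c)) (sym (·ᵥ-identity _)))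
      where c = shear i s (swap i s p) (pos q e k)

    unit≡e⟨⟩ : ∀ c → unit q e c ≡ e⟨ from c ⟩
    unit≡e⟨⟩ c = lookup-ext (λ j → trans (lookup∘tabulate _ j) (trans (same j) (sym (lookup-e⟨⟩ (from c) j))))
      where
      same : ∀ j → (if ⌊ ≡-dec _≟_ (pos q e j) c ⌋ then 𝟏 else 𝟎) ≡ (if ⌊ from c ≟ j ⌋ then 𝟏 else 𝟎)
      same j with ≡-dec _≟_ (pos q e j) c | from c ≟ j
      ... | yes _  | yes _  = refl
      ... | no _   | no _   = refl
      ... | yes eq | no neq = ⊥-elim (neq (trans (cong from (sym eq)) (Inverse.strictlyInverseʳ e j)))
      ... | no neq | yes eq = ⊥-elim (neq (trans (cong (pos q e) (sym eq)) (Inverse.strictlyInverseˡ e c)))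

    lincomb-unit : ∀ c → lincomb q (unit q e c) Ĥ ≡ 𝟏 ∷ c
    lincomb-unit c = trans (cong (λ y → lincomb q y Ĥ) (unit≡e⟨⟩ c)) (trans (lincomb-e⟨⟩ (from c) Ĥ) (lookup-Ĥ-from c))

    lincomb-1∷ : ∀ {k m} (y : Vec (F q) k) (g : Fin k → Vec (F q) m) →
      lincomb q y (tabulate (λ j → 𝟏 ∷ g j)) ≡ sumF q y ∷ lincomb q y (tabulate g)
    lincomb-1∷ []      g = refl
    lincomb-1∷ (a ∷ y) g = trans (cong (a ·ᵥ (𝟏 ∷ g Fin.zero) +ᵥ_) (lincomb-1∷ y (g ∘ Fin.suc)))
      (cong (λ c → c ⊕ sumF q y ∷ a ·ᵥ g Fin.zero +ᵥ lincomb q y (tabulate (g ∘ Fin.suc))) (*F-identityʳ a))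

    D⇒lincomb : ∀ {d} → D q e d → lincomb q d Ĥ ≡ 0ᵥ
    D⇒lincomb {d} (sum≡0 , moment≡0) = trans (lincomb-1∷ d (pos q e)) (cong₂ _∷_ sum≡0 moment≡0)

    lincomb⇒D : ∀ {d} → lincomb q d Ĥ ≡ 0ᵥ → D q e d
    lincomb⇒D {d} eq = ∷-injective (trans (sym (lincomb-1∷ d (pos q e))) eq)

    Dc⇒lincomb : ∀ {t y} → Dc q e t y → lincomb q y Ĥ ≡ 𝟎 ∷ -ᵥ t
    Dc⇒lincomb {t} (d , Dd , refl) = begin
      lincomb q (d +ᵥ unit q e 0ᵥ +ᵥ -ᵥ unit q e t) Ĥ
        ≡⟨ linear-+ lin (d +ᵥ unit q e 0ᵥ) (-ᵥ unit q e t) ⟩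
      lincomb q (d +ᵥ unit q e 0ᵥ) Ĥ +ᵥ lincomb q (-ᵥ unit q e t) Ĥ
        ≡⟨ cong₂ _+ᵥ_
             (trans (linear-+ lin d (unit q e 0ᵥ)) (cong₂ _+ᵥ_ (D⇒lincomb {d} Dd) (lincomb-unit 0ᵥ)))
             (trans (linear-neg lin (unit q e t)) (cong -ᵥ_ (lincomb-unit t))) ⟩
      0ᵥ +ᵥ (𝟏 ∷ 0ᵥ) +ᵥ -ᵥ (𝟏 ∷ t)
        ≡⟨ cong (_+ᵥ -ᵥ (𝟏 ∷ t)) (+ᵥ-identityˡ (𝟏 ∷ 0ᵥ)) ⟩
      (𝟏 ∷ 0ᵥ) +ᵥ -ᵥ (𝟏 ∷ t)
        ≡⟨ cong₂ _∷_ (+F-inverseʳ 𝟏) (+ᵥ-identityˡ (-ᵥ t)) ⟩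
      𝟎 ∷ -ᵥ t ∎
      where
      open ≡-Reasoning
      lin = lincomb-linear Ĥ

    lincomb⇒Dc : ∀ {t y} → lincomb q y Ĥ ≡ 𝟎 ∷ -ᵥ t → Dc q e t y
    lincomb⇒Dc {t} {y} eq = d , lincomb⇒D {d} Ĥd≡0 , sym (trans
        (cong (_+ᵥ -ᵥ unit q e t) (x-y+y≡x (unit q e 0ᵥ) (y +ᵥ unit q e t))) (x+y-y≡x (unit q e t) y))
      where
      open ≡-Reasoning
      lin = lincomb-linear Ĥ
      -- Solves `y = d + e_0 − e_t` for `d`.
      d = y +ᵥ unit q e t +ᵥ -ᵥ unit q e 0ᵥ
      Ĥd≡0 : lincomb q d Ĥ ≡ 0ᵥ
      Ĥd≡0 = begin
        lincomb q d Ĥ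
          ≡⟨ linear-+ lin (y +ᵥ unit q e t) (-ᵥ unit q e 0ᵥ) ⟩
        lincomb q (y +ᵥ unit q e t) Ĥ +ᵥ lincomb q (-ᵥ unit q e 0ᵥ) Ĥ
          ≡⟨ cong₂ _+ᵥ_
               (trans (linear-+ lin y (unit q e t)) (cong₂ _+ᵥ_ eq (lincomb-unit t)))
               (trans (linear-neg lin (unit q e 0ᵥ)) (cong -ᵥ_ (lincomb-unit 0ᵥ))) ⟩
        (𝟎 ∷ -ᵥ t) +ᵥ (𝟏 ∷ t) +ᵥ -ᵥ (𝟏 ∷ 0ᵥ)
          ≡⟨ cong (_+ᵥ -ᵥ (𝟏 ∷ 0ᵥ)) (cong₂ _∷_ (+F-identityˡ 𝟏) (+ᵥ-inverseˡ t)) ⟩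
        (𝟏 ∷ 0ᵥ) +ᵥ -ᵥ (𝟏 ∷ 0ᵥ)
          ≡⟨ +ᵥ-inverseʳ (𝟏 ∷ 0ᵥ) ⟩
        0ᵥ ∎

    code : Vec (F q) (n + Q) → Set
    code = S q e H (τ i s)

    code⇒degree : ∀ {w} → code w → ∃[ p ] HasDegree p w
    -- With `p = φ⁻¹ a`, the value `τ a` unfolds to `φ (swap p)`, so the second syndrome is `ψ₂ p`
    -- as it stands.
    code⇒degree (a , x , y , Hx≡a , Dy , refl) = φ⁻¹ i s a ,
      trans (cong (λ x → lincomb q x H) (take-++ x y)) (trans Hx≡a (sym (φ-φ⁻¹ i s a))) ,
      trans (cong (λ y → lincomb q y Ĥ) (drop-++ x y)) (Dc⇒lincomb Dy)

    degree⇒code : ∀ {p w} → HasDegree p w → code w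
    degree⇒code {p} {w} (eq₁ , eq₂) = φ i s p , take n w , drop n w , eq₁ ,
      lincomb⇒Dc (trans eq₂ (cong (λ p → ψ₂ p) (sym (φ⁻¹-φ i s p)))) , sym (take++drop≡id n w)

    surjective₁ : ∀ a → ∃[ x ] lincomb q x H ≡ a
    surjective₁ a with ≡-dec _≟_ a 0ᵥ
    ... | yes refl = 0ᵥ , lincomb-zeros H
    ... | no a≢0   = let j , ν , eq = cover a a≢0 in
      ν ·ᵥ e⟨ j ⟩ , trans (linear-· (lincomb-linear H) ν e⟨ j ⟩) (trans (cong (ν ·ᵥ_) (lincomb-e⟨⟩ j H)) (sym eq))

    surjective₂ : ∀ b → ∃[ y ] lincomb q y Ĥ ≡ b
    -- `unit b` already contributes `b` to `Σ y_c c` and 1 to `Σ y_c`. Position zero affects only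
    -- the sum of the entries, so `σ − 1` there corrects it.
    surjective₂ (σ ∷ b) = (σ ⊕ ⊖ 𝟏) ·ᵥ unit q e 0ᵥ +ᵥ unit q e b , (begin
      lincomb q ((σ ⊕ ⊖ 𝟏) ·ᵥ unit q e 0ᵥ +ᵥ unit q e b) Ĥ
        ≡⟨ lincomb-linear Ĥ (σ ⊕ ⊖ 𝟏) (unit q e 0ᵥ) (unit q e b) ⟩
      (σ ⊕ ⊖ 𝟏) ·ᵥ lincomb q (unit q e 0ᵥ) Ĥ +ᵥ lincomb q (unit q e b) Ĥ
        ≡⟨ cong₂ (λ u v → (σ ⊕ ⊖ 𝟏) ·ᵥ u +ᵥ v) (lincomb-unit 0ᵥ) (lincomb-unit b) ⟩
      (σ ⊕ ⊖ 𝟏) ·ᵥ (𝟏 ∷ 0ᵥ) +ᵥ (𝟏 ∷ b)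
        ≡⟨ cong₂ _∷_
             (trans (cong (_⊕ 𝟏) (*F-identityʳ (σ ⊕ ⊖ 𝟏))) (trans (+F-assoc σ (⊖ 𝟏) 𝟏)
               (trans (cong (σ ⊕_) (+F-inverseˡ 𝟏)) (+F-identityʳ σ))))
             (trans (cong (_+ᵥ b) (·ᵥ-zeroʳ (σ ⊕ ⊖ 𝟏))) (+ᵥ-identityˡ b)) ⟩
      σ ∷ b ∎)
      where open ≡-Reasoning

    syndromes-surjective : ∀ a b → ∃[ w ] syndrome₁ w ≡ a × syndrome₂ w ≡ b
    syndromes-surjective a b = let x , x-eq = surjective₁ a
                                   y , y-eq = surjective₂ b in
      x ++ y , trans (cong (λ x → lincomb q x H) (take-++ x y)) x-eq , trans (cong (λ y → lincomb q y Ĥ) (drop-++ x y)) y-eq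

    -- The span of the code will be the kernel of κ.
    κ : Vec (F q) (n + Q) → Vec (F q) (ℕ.suc s)
    κ w = head (syndrome₂ w) ∷ fixed i s (syndrome₁ w) +ᵥ fixed i s (tail (syndrome₂ w))

    κ-linear : Linear κ
    κ-linear c u v = cong₂ _∷_
      (trans (cong head (syndrome₂-linear c u v)) (head-linear c (syndrome₂ u) (syndrome₂ v)))
      (trans (cong₂ _+ᵥ_
          (linear-∘ (fixed-linear i s) syndrome₁-linear c u v)
          (linear-∘ (linear-∘ (fixed-linear i s) tail-linear) syndrome₂-linear c u v))
        (trans (+ᵥ-interchange _ _ _ _) (cong (_+ᵥ tail (κ v)) (sym (·ᵥ-distribˡ c _ _)))))

    κ-surjective : ∀ a → ∃[ w ] κ w ≡ a
    κ-surjective (σ ∷ z) = let w , eq₁ , eq₂ = syndromes-surjective 0ᵥ (σ ∷ pad i s z) in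
      w , cong₂ _∷_ (cong head eq₂)
        (trans (cong₂ (λ a b → fixed i s a +ᵥ fixed i s (tail b)) eq₁ eq₂)
          (trans (cong₂ _+ᵥ_ (linear-0 (fixed-linear i s)) (fixed-pad i s z)) (+ᵥ-identityˡ z)))

    -- On the complement both `φ` and `swap` are the identity, so the two syndromes of a codeword
    -- cancel there.
    code⊆kernel : ∀ {w} → code w → κ w ≡ 0ᵥ
    code⊆kernel w∈code = let p , eq₁ , eq₂ = code⇒degree w∈code in
      cong₂ _∷_ (cong head eq₂) (trans (cong₂ (λ a b → fixed i s a +ᵥ fixed i s (tail b)) eq₁ eq₂)
        (trans (cong₂ _+ᵥ_ (fixed-φ i s p) (trans (linear-neg (fixed-linear i s) _)
            (cong -ᵥ_ (trans (fixed-φ i s (swap i s p)) (fixed-swap i s p)))))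
          (+ᵥ-inverseʳ _)))

    -- Reduces the claim about words to `graph-generated`, which concerns only syndromes.
    kernel⊆span : ∀ w → κ w ≡ 0ᵥ → InSpan q code w
    kernel⊆span w κw≡0 = let h , h+h≡1 = half 3≤q in
      graph-generated h h+h≡1 i s {X = X} closed (λ p w eq₁ eq₂ → InSpan-∈ (degree⇒code (eq₁ , eq₂)))
        (syndrome₁ w) (tail (syndrome₂ w)) (proj₂ (∷-injective κw≡0)) w refl
        (split (syndrome₂ w) (proj₁ (∷-injective κw≡0)))
      where
      -- Quantifying over all words with given syndromes makes `X` depend on the syndromes alone.
      -- For the generators every such word is itself a codeword.
      X : Vec (F q) r → Vec (F q) r → Set
      X a b = ∀ w → syndrome₁ w ≡ a → syndrome₂ w ≡ 𝟎 ∷ b → InSpan q code w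
      split : (u : Vec (F q) (ℕ.suc r)) → head u ≡ 𝟎 → u ≡ 𝟎 ∷ tail u
      split (_ ∷ u) eq = cong (_∷ u) eq
      closed : ∀ c {u v u′ v′} → X u v → X u′ v′ → X (c ·ᵥ u +ᵥ u′) (c ·ᵥ v +ᵥ v′)
      closed c {u} {v} {u′} {v′} Xu Xv w eq₁ eq₂ =
        -- Any word with the first pair of syndromes may be split off from `w`; linearity then
        -- forces the remainder `w₂` to have the second pair.
        let w₁ , w₁-eq₁ , w₁-eq₂ = syndromes-surjective u (𝟎 ∷ v)
            w₂ = w +ᵥ -ᵥ (c ·ᵥ w₁)
            c·w₁+w₂≡w = trans (+ᵥ-comm (c ·ᵥ w₁) w₂) (x-y+y≡x (c ·ᵥ w₁) w)
        in subst (InSpan q code) c·w₁+w₂≡w (InSpan-closed c (Xu w₁ w₁-eq₁ w₁-eq₂) (Xv w₂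
             (+ᵥ-cancelˡ (c ·ᵥ u) _ _ (trans (cong (λ a → c ·ᵥ a +ᵥ syndrome₁ w₂) (sym w₁-eq₁))
               (trans (sym (syndrome₁-linear c w₁ w₂)) (trans (cong syndrome₁ c·w₁+w₂≡w) eq₁))))
             (+ᵥ-cancelˡ (c ·ᵥ (𝟎 ∷ v)) _ _ (trans (cong (λ a → c ·ᵥ a +ᵥ syndrome₂ w₂) (sym w₁-eq₂))
               (trans (sym (syndrome₂-linear c w₁ w₂)) (trans (cong syndrome₂ c·w₁+w₂≡w) (trans eq₂
                 (cong (_∷ (c ·ᵥ v +ᵥ v′)) (sym (trans (+F-identityʳ _) (zeroʳ c)))))))))))

  S-propelinear : IsPropelinear q (S q e H (τ i s))
  S-propelinear = cocycleCode-propelinear check Ĥ-check shear-permutesLines swapped-permutesLines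
    (φ-injective i s) code⇒degree degree⇒code

  S-rank : ∀ {k} → ℕ.suc s + k ≡ n + q ^ dim i s → HasRank q (S q e H (τ i s)) k
  S-rank dims = let b , indep , inKernel , spanning = kernel-basis (ℕ.suc s) κ κ-linear κ-surjective dims in
    -- Each basis vector is the combination with coefficients `e⟨ j ⟩`, so `inKernel` applies to it.
    b , All.lookup⁻ (λ j → kernel⊆span _ (trans (cong κ (sym (lincomb-e⟨⟩ j b))) (inKernel e⟨ j ⟩)))
      , indep , (λ v v∈code → spanning v (code⊆kernel v∈code))

-- Dimension count and conclusion

dim≡2i+s : ∀ i s → dim i s ≡ 2 * i + s
dim≡2i+s ℕ.zero    s = refl
dim≡2i+s (ℕ.suc i) s = cong ℕ.suc (trans (cong ℕ.suc (dim≡2i+s i s)) (cong (_+ s) (sym (ℕₚ.+-suc i (i + 0)))))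

-- The code spans a subspace of codimension s + 1 with s = r - 2i; `r < N` lets the truncated
-- subtractions behave as integer ones.
codimension : ∀ i s N → dim i s < N → ℕ.suc s + (N ∸ dim i s ∸ 1 + 2 * i) ≡ N
codimension i s N r<N = begin
  ℕ.suc s + (N ∸ r ∸ 1 + 2 * i)       ≡⟨ cong (λ a → ℕ.suc s + (a + 2 * i)) (ℕₚ.∸-+-assoc N r 1) ⟩
  ℕ.suc s + (N ∸ (r + 1) + 2 * i)     ≡⟨ cong (ℕ.suc s +_) (ℕₚ.+-comm (N ∸ (r + 1)) (2 * i)) ⟩
  ℕ.suc s + (2 * i + (N ∸ (r + 1)))   ≡⟨ ℕₚ.+-assoc (ℕ.suc s) (2 * i) _ ⟨
  ℕ.suc (s + 2 * i) + (N ∸ (r + 1))   ≡⟨ cong (λ a → ℕ.suc a + (N ∸ (r + 1))) (trans (ℕₚ.+-comm s (2 * i)) (sym (dim≡2i+s i s))) ⟩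
  ℕ.suc r + (N ∸ (r + 1))             ≡⟨ cong (λ a → a + (N ∸ (r + 1))) (ℕₚ.+-comm 1 r) ⟩
  r + 1 + (N ∸ (r + 1))               ≡⟨ ℕₚ.m+[n∸m]≡n (subst (_≤ N) (ℕₚ.+-comm 1 r) r<N) ⟩
  N                                   ∎
  where
  open ≡-Reasoning
  r = dim i s

theorem5 : (q : ℕ) .{{_ : NonZero q}} → Prime q → 3 ≤ q →
    (r : ℕ) → 2 ≤ r → (i : ℕ) → i ≤ r / 2 →
    (H : Vec (Vec (F q) r) (geomLen q r)) → IsHammingCheck q r (geomLen q r) H →
    (e : Fin (q ^ r) ↔ Vec (F q) r) →
    ∃[ τ ] (IsPropelinear q (S q e H τ)
    × (geomLen q r + q ^ r ≡ geomLen q (r + 1))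
    × HasRank q (S q e H τ) (geomLen q (r + 1) ∸ r ∸ 1 + 2 * i))
theorem5 q p 3≤q r _ i i≤r/2 = construct (r ∸ 2 * i) r (trans (dim≡2i+s i (r ∸ 2 * i)) (ℕₚ.m+[n∸m]≡n 2i≤r))
  where
  2i≤r : 2 * i ≤ r
  2i≤r = ℕₚ.≤-trans (subst (_≤ r / 2 * 2) (ℕₚ.*-comm i 2) (ℕₚ.*-monoˡ-≤ 2 i≤r/2)) (m/n*n≤m r 2)

  2≤q : 2 ≤ q
  2≤q = ℕₚ.≤-trans (ℕₚ.n≤1+n 2) 3≤q

  -- `r` is kept as a variable equal to `dim i s`, so that matching on `refl` puts `H` and `e`,
  -- whose types mention `r`, into the plane-by-plane form.
  construct : ∀ s r → dim i s ≡ r →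
    (H : Vec (Vec (F q) r) (geomLen q r)) → IsHammingCheck q r (geomLen q r) H →
    (e : Fin (q ^ r) ↔ Vec (F q) r) →
    ∃[ τ ] (IsPropelinear q (S q e H τ)
    × (geomLen q r + q ^ r ≡ geomLen q (r + 1))
    × HasRank q (S q e H τ) (geomLen q (r + 1) ∸ r ∸ 1 + 2 * i))
  construct s r refl H check e =
      Shears.τ q i s
    , S-propelinear q p 3≤q i s H check e (geomLen-count r 2≤q)
    , geomLen-suc r 2≤q
    , S-rank q p 3≤q i s H check e (geomLen-count r 2≤q)
        (trans (codimension i s (geomLen q (r + 1)) r<N) (sym (geomLen-suc r 2≤q)))
    where
    r<N : r < geomLen q (r + 1)
    r<N = subst (r <_) (geomLen-suc r 2≤q) (ℕₚ.≤-trans (m<q^m r 2≤q) (ℕₚ.m≤n+m (q ^ r) (geomLen q r)))
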